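{- Let $k\ge 2$ and let $p_1,\ldots,p_k$ be nonnegative integers. The dual-opening gives a bijection between tree-pointed $k$-constellations of reduced type $(p_1,\ldots,p_k)$ and rooted $k$-nebulas of type $(p_1,\ldots,p_k)$.
   Context: $[m]=\{1,\ldots,m\}$. A map is a cellular embedding (all faces simply connected) of a connected graph (loops and multiple edges allowed) in an oriented compact connected surface without boundary, considered up to orientation preserving homeomorphism. A $k$-constellation is a map with black and white faces and with vertices of types $1,\ldots,k$ (types taken modulo $k$) such that (i) each edge separates a black face and a white face, and (ii) each black face has degree $k$ and is incident to vertices of type $1,2,\ldots,k$ in this order clockwise around the face. Black faces are called hyperedges. An edge has type $t\in[k]$ if, clockwise around its incident hyperedge, it goes from a vertex of type $t$ to a vertex of type $t+1$. A constellation is rooted if one hyperedge is distinguished (root hyperedge). It has type $(q_1,\ldots,q_k)$ if it has $q_t$ vertices of type $t$ for all $t$. For a vertex $v_0$ of a constellation $C$, a $v_0$-arborescence of $C$ is a spanning tree $A$ of $C$ such that every vertex $v\ne v_0$ of type $t$ is incident to exactly one edge of type $t$ in $A$. A tree-pointed $k$-constellation is a pair $(C,A)$ where $C$ is a rooted $k$-constellation and $A$ is a $v_0$-arborescence for some vertex $v_0$ (not necessarily incident to the root hyperedge). If $C$ has type $(q_1,\ldots,q_k)$ and $v_0$ has type $t$, then $(C,A)$ has reduced type $(p_1,\ldots,p_k)$ where $p_t=q_t-1$ and $p_s=q_s$ for $s\ne t$. A bud is a dangling half-edge (a half-edge not part of a complete edge). A $k$-nebula is a map having a single face, with black and white vertices,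 edges of types $1,\ldots,k$ and buds of types $1,\ldots,k$, such that (i) each edge joins a black and a white vertex; (ii) each black vertex has degree $k$ (counting buds); (iii) in clockwise order around a black vertex (resp. white vertex) the type of the edges or buds increases (resp. decreases) by one modulo $k$ from one half-edge to the next; (iv) for all $t\in[k]$ the number of buds of type $t$ incident to black vertices equals the number of buds of type $t$ incident to white vertices. It is rooted if one black vertex is distinguished (root vertex). It has type $(p_1,\ldots,p_k)$ if it has $p_t$ buds of type $t$ incident to black vertices, for all $t$. The dual $C^*$ of a $k$-constellation $C$ has a vertex in each face of $C$ (black or white according to the face) and an edge across each edge of $C$ (of the same type). The dual-opening of $(C,A)$, where $A$ is a spanning tree of $C$, is the map with buds obtained from $C^*$ by cutting into two halves each edge of $C^*$ crossing an edge of $A$ (an edge of type $t$ gives two buds of type $t$); its root vertex is the black vertex dual to the root hyperedge of $C$. -}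

module Defs where

open import Data.Bool using (Bool; true; false; if_then_else_)
open import Data.Empty using (⊥-elim)
open import Data.Fin using (Fin; toℕ)
open import Data.Fin.Permutation
  using (Permutation; Permutation′; permutation; _⟨$⟩ʳ_; _⟨$⟩ˡ_; inverseˡ; inverseʳ)
open import Data.Nat using (ℕ; suc)
open import Data.Nat.DivMod using (_mod_)
open import Data.Product using (Σ-syntax; ∃-syntax; ∃!; _×_; proj₁)
open import Data.Sum using (_⊎_)
open import Data.Unit using (⊤)
open import Function using (Inverse)
open import Level using (0ℓ)
open import Relation.Binary using (Setoid)
import Relation.Binary.Construct.Closure.Equivalence as EqC
import Relation.Binary.Construct.On as On
open import Relation.Binary.PropositionalEquality
  using (_≡_; _≢_; refl; trans; cong; setoid)
open import Relation.Nullary using (¬_)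

-- The types 1,…,k are represented by Fin k; next is t ↦ t + 1 modulo k.
next : ∀ {k} → Fin k → Fin k
next {suc k} t = suc (toℕ t) mod suc k

infix 4 _HasSize_

_HasSize_ : Setoid 0ℓ 0ℓ → ℕ → Set
S HasSize m = Inverse (setoid (Fin m)) S

Elements : ∀ {n} → (Fin n → Set) → Setoid 0ℓ 0ℓ
Elements P = On.setoid (setoid _) (proj₁ {B = P})

Steps : ∀ {n} → (Fin n → Fin n) → Fin n → Fin n → Set
Steps f x y = f x ≡ y

-- For a bijection f of a finite set, SameOrbit f x y says that x and y lie
-- on the same cycle of f.
SameOrbit : ∀ {n} → (Fin n → Fin n) → Fin n → Fin n → Set
SameOrbit f = EqC.EqClosure (Steps f)

-- The cycles of f, restricted to representatives satisfying P (which will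
-- always be invariant under f).
Orbits : ∀ {n} → (Fin n → Fin n) → (Fin n → Set) → Setoid 0ℓ 0ℓ
Orbits f P = On.setoid (EqC.setoid (Steps f)) (proj₁ {B = P})

data Colour : Set where
  black white : Colour

-- Cellular embeddings of graphs in oriented surfaces, up to orientation
-- preserving homeomorphism, are encoded by rotation systems on the finite
-- set of darts (half-edges).  A dart d leaves its vertex along its edge;
-- σ d is the dart following d clockwise around that vertex, and α d is the
-- other dart of the same edge.  A fixed point of α is a bud.
--
-- φ d is the dart following d on the boundary of the face lying on the right
-- of d, so φ traverses each face clockwise.  Vertices, edges (or buds) and
-- faces are the orbits of σ, α and φ.
record RotationSystem : Set where
  field
    size         : ℕ
    σ            : Permutation′ size
    α            : Fin size → Fin size
    α-involutive : ∀ d → α (α d) ≡ d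

  Dart : Set
  Dart = Fin size

  φ : Dart → Dart
  φ d = σ ⟨$⟩ˡ (α d)

  SameVertex SameEdge SameFace : Dart → Dart → Set
  SameVertex = SameOrbit (σ ⟨$⟩ʳ_)
  SameEdge   = SameOrbit α
  SameFace   = SameOrbit φ

  IsBud : Dart → Set
  IsBud d = α d ≡ d

  -- Connectedness of the graph formed by all the vertices and by those edges
  -- whose darts satisfy E.
  ConnectedBy : (Dart → Set) → Set
  ConnectedBy E = ∀ d e →
    EqC.EqClosure (λ x y → SameVertex x y ⊎ (E x × α x ≡ y)) d e

  Connected : Set
  Connected = ConnectedBy (λ _ → ⊤)

record EdgeSet (M : RotationSystem) : Set where
  open RotationSystem M
  field
    member   : Dart → Bool
    member-α : ∀ d → member (α d) ≡ member d

module _ {M : RotationSystem} (A : EdgeSet M) where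
  open RotationSystem M
  open EdgeSet A

  InSet : Dart → Set
  InSet d = member d ≡ true

  -- A closed path of length ≥ 1 using edges of A, without repeated vertices
  -- or edges.
  record Cycle : Set where
    field
      {length-1}        : ℕ
      dart              : Fin (suc length-1) → Dart
      in-set            : ∀ i → InSet (dart i)
      consecutive       : ∀ i → SameVertex (α (dart i)) (dart (next i))
      distinct-vertices : ∀ i j → SameVertex (dart i) (dart j) → i ≡ j
      distinct-edges    : ∀ i j → SameEdge (dart i) (dart j) → i ≡ j

  record IsSpanningTree : Set where
    field
      connected : ConnectedBy InSet
      acyclic   : ¬ Cycle

-- Rooted k-constellations.  faceColour d is the colour of the face on the
-- right of d, and vertexType d is the type of the vertex which d leaves.  The
-- root hyperedge is given by any one of the darts having it on the right.
record RootedConstellation (k : ℕ) : Set where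
  field
    system : RotationSystem
  open RotationSystem system public
  field
    no-buds      : ∀ d → ¬ IsBud d
    connected    : Connected
    faceColour   : Dart → Colour
    faceColour-φ : ∀ d → faceColour (φ d) ≡ faceColour d
    vertexType   : Dart → Fin k
    vertexType-σ : ∀ d → vertexType (σ ⟨$⟩ʳ d) ≡ vertexType d
    separates    : ∀ d → faceColour (α d) ≢ faceColour d
    black-degree : ∀ d → faceColour d ≡ black → Elements (SameFace d) HasSize k
    black-types  : ∀ d → faceColour d ≡ black →
                   vertexType (φ d) ≡ next (vertexType d)
    root         : Dart
    root-black   : faceColour root ≡ black

  -- The dart of the edge having the incident hyperedge on its right is the
  -- one following that hyperedge clockwise.
  edgeType : Dart → Fin k
  edgeType d with faceColour d
  ... | black = vertexType d
  ... | white = vertexType (α d)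

  edgeType-α : ∀ d → edgeType (α d) ≡ edgeType d
  edgeType-α d with faceColour (α d) | faceColour d | separates d
  ... | black | black | neq = ⊥-elim (neq refl)
  ... | black | white | neq = refl
  ... | white | black | neq = cong vertexType (α-involutive d)
  ... | white | white | neq = ⊥-elim (neq refl)

  -- Vertices are given by any of the darts leaving them.
  IncidentTo : Dart → Dart → Set
  IncidentTo v e = SameVertex v e ⊎ SameVertex v (α e)

  HasVertexCounts : (Fin k → ℕ) → Set
  HasVertexCounts q =
    ∀ t → Orbits (σ ⟨$⟩ʳ_) (λ d → vertexType d ≡ t) HasSize q t

  record IsArborescence (v₀ : Dart) (A : EdgeSet system) : Set where
    field
      spanning-tree : IsSpanningTree A
      unique-edge   : ∀ v → ¬ SameVertex v v₀ →
        ∃! SameEdge (λ e → InSet A e × edgeType e ≡ vertexType v × IncidentTo v e)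

-- The pairs (C , A) of reduced type p.  The vertex v₀ is only asserted to
-- exist: it plays no role in the isomorphism relation below.
record TreePointed {k : ℕ} (p : Fin k → ℕ) : Set where
  field
    constellation : RootedConstellation k
  open RootedConstellation constellation public
  field
    tree          : EdgeSet system
    arborescence  : ∃[ v₀ ] ∃[ q ]
      IsArborescence v₀ tree
      × HasVertexCounts q
      × q (vertexType v₀) ≡ suc (p (vertexType v₀))
      × (∀ s → s ≢ vertexType v₀ → q s ≡ p s)
  open EdgeSet tree public

-- A rotation system, possibly with buds, whose vertices are coloured, whose
-- edges and buds are typed, and in which a black vertex is distinguished (by
-- any of its darts).
record RootedBudMap (k : ℕ) : Set where
  field
    system : RotationSystem
  open RotationSystem system public
  field
    vertexColour   : Dart → Colour
    vertexColour-σ : ∀ d → vertexColour (σ ⟨$⟩ʳ d) ≡ vertexColour d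
    edgeType       : Dart → Fin k
    edgeType-α     : ∀ d → edgeType (α d) ≡ edgeType d
    root           : Dart
    root-black     : vertexColour root ≡ black

  Buds : Colour → Fin k → Setoid 0ℓ 0ℓ
  Buds c t = Elements (λ d → IsBud d × vertexColour d ≡ c × edgeType d ≡ t)

module _ {k : ℕ} (N : RootedBudMap k) where
  open RootedBudMap N

  record IsNebula : Set where
    field
      connected     : Connected
      single-face   : ∀ d e → SameFace d e
      bicoloured    : ∀ d → ¬ IsBud d → vertexColour (α d) ≢ vertexColour d
      black-degree  : ∀ d → vertexColour d ≡ black →
                      Elements (SameVertex d) HasSize k
      black-types   : ∀ d → vertexColour d ≡ black →
                      edgeType (σ ⟨$⟩ʳ d) ≡ next (edgeType d)
      white-types   : ∀ d → vertexColour d ≡ white →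
                      next (edgeType (σ ⟨$⟩ʳ d)) ≡ edgeType d
      balanced-buds : ∀ t → ∃[ m ] Buds black t HasSize m × Buds white t HasSize m

  IsNebulaOfType : (Fin k → ℕ) → Set
  IsNebulaOfType p = IsNebula × (∀ t → Buds black t HasSize p t)

Nebula : ∀ {k} → (Fin k → ℕ) → Set
Nebula {k} p = Σ[ N ∈ RootedBudMap k ] IsNebulaOfType N p

-- The dual dart of d crosses d, going from the face on the right of d to the
-- face on its left.  Hence the clockwise rotation around a dual vertex is the
-- clockwise traversal φ of the corresponding face.
dual : RotationSystem → RotationSystem
dual M = record
  { size         = size
  ; σ            = permutation φ (λ d → α (σ ⟨$⟩ʳ d))
                     (λ d → trans (cong (σ ⟨$⟩ˡ_) (α-involutive _)) (inverseˡ σ))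
                     (λ d → trans (cong α (inverseʳ σ)) (α-involutive d))
  ; α            = α
  ; α-involutive = α-involutive
  }
  where open RotationSystem M

dualEdges : ∀ {M} → EdgeSet M → EdgeSet (dual M)
dualEdges A = record { member = member ; member-α = member-α }
  where open EdgeSet A

-- Cutting the edges of A: each of their darts becomes a bud.
cut : (M : RotationSystem) → EdgeSet M → RotationSystem
cut M A = record
  { size         = size
  ; σ            = σ
  ; α            = β
  ; α-involutive = β-involutive
  }
  where
  open RotationSystem M
  open EdgeSet A

  β : Dart → Dart
  β d = if member d then d else α d

  β-involutive : ∀ d → β (β d) ≡ d
  β-involutive d with member d in eq
  ... | true  rewrite eq = refl
  ... | false rewrite trans (member-α d) eq = α-involutive d

dualOpening : ∀ {k} (C : RootedConstellation k) →
              EdgeSet (RootedConstellation.system C) → RootedBudMap k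
dualOpening C A = record
  { system         = cut (dual system) (dualEdges A)
  ; vertexColour   = faceColour
  ; vertexColour-σ = faceColour-φ
  ; edgeType       = edgeType
  ; edgeType-α     = edgeType-cut
  ; root           = root
  ; root-black     = root-black
  }
  where
  open RootedConstellation C
  open EdgeSet A

  edgeType-cut : ∀ d → edgeType (if member d then d else α d) ≡ edgeType d
  edgeType-cut d with member d
  ... | true  = refl
  ... | false = edgeType-α d

treeOpening : ∀ {k} {p : Fin k → ℕ} → TreePointed p → RootedBudMap k
treeOpening X = dualOpening constellation tree
  where open TreePointed X

record Isomorphism (M N : RotationSystem) : Set where
  private
    module M = RotationSystem M
    module N = RotationSystem N
  field
    bijection : Permutation M.size N.size

  to : M.Dart → N.Dart
  to = bijection ⟨$⟩ʳ_

  field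
    to-σ : ∀ d → to (M.σ ⟨$⟩ʳ d) ≡ N.σ ⟨$⟩ʳ (to d)
    to-α : ∀ d → to (M.α d) ≡ N.α (to d)

-- Two tree-pointed constellations, or two nebulas, are the same when they
-- are related by an isomorphism preserving colours, types, tree and root.
record _≅ᵀ_ {k} {p : Fin k → ℕ} (X Y : TreePointed p) : Set where
  private
    module X = TreePointed X
    module Y = TreePointed Y
  field
    isomorphism : Isomorphism X.system Y.system
  open Isomorphism isomorphism public
  field
    to-colour : ∀ d → Y.faceColour (to d) ≡ X.faceColour d
    to-type   : ∀ d → Y.vertexType (to d) ≡ X.vertexType d
    to-tree   : ∀ d → Y.member (to d) ≡ X.member d
    to-root   : Y.SameFace (to X.root) Y.root

record _≅ᴺ_ {k} {p : Fin k → ℕ} (X Y : Nebula p) : Set where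
  private
    module X = RootedBudMap (proj₁ X)
    module Y = RootedBudMap (proj₁ Y)
  field
    isomorphism : Isomorphism X.system Y.system
  open Isomorphism isomorphism public
  field
    to-colour : ∀ d → Y.vertexColour (to d) ≡ X.vertexColour d
    to-type   : ∀ d → Y.edgeType (to d) ≡ X.edgeType d
    to-root   : Y.SameVertex (to X.root) Y.root

{-# OPTIONS --safe #-}

-- Read around its single face, a nebula is a cyclic word in which black buds are
-- opening and white buds closing parentheses: if it comes from (C , A), the face
-- is the contour of the tree A, which enters a vertex from its parent at a black
-- bud and leaves it at the matching white one.  So C can only be recovered by
-- gluing matching buds.  Conversely a balanced cyclic word has a unique matching,
-- and matching buds have the same type because types vary like the height of the
-- word modulo k.  After gluing, the height is constant around each vertex, and
-- every vertex except the lowest has a unique black bud, leading to a lower vertex: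
-- these buds form an arborescence.
module Submission where

open import Defs
open import Data.Bool using (Bool; true; false; if_then_else_)
open import Data.Empty using (⊥-elim)
open import Data.Fin using (Fin; zero; suc; toℕ; fromℕ<; punchIn; punchOut)
open import Data.Fin.Induction using (spo-wellFounded)
import Data.Fin.Permutation as Perm
open Perm using
  (Permutation; permutation; id; _⟨$⟩ʳ_; _⟨$⟩ˡ_; inverseˡ; inverseʳ; _∘ₚ_)
open import Data.Fin.Properties
  using (_≟_; any?; pigeonhole; toℕ<n; toℕ-injective; toℕ-fromℕ<; punchInᵢ≢i;
         punchIn-punchOut; punchIn-injective)
open import Data.Nat using (ℕ; zero; suc; _+_; _*_; _∸_; _≤_; _<_; z≤n; s≤s; _%_; _/_; _<?_)
open import Data.Nat.DivMod using (_mod_; m≡m%n+[m/n]*n; m%n<n; m<n⇒m%n≡m; n%n≡0)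
open import Data.Nat.GeneralisedArithmetic using (iterate)
open import Data.Nat.Induction using (Acc; acc; <-wellFounded)
open import Data.Nat.Properties
  using (+-comm; +-assoc; +-suc; +-identityʳ; +-monoʳ-≤; +-0-commutativeMonoid;
         +-commutativeSemigroup; +-∸-assoc; n∸n≡0; ∸-monoʳ-<; anyUpTo?; n<1+n;
         m≤n⇒∃[o]m+o≡n; m≤n⇒m<n∨m≡n; m≤m+n; m≤n+m; ≤-pred; ≤-refl; ≤-reflexive; ≤-trans;
         <-≤-trans; ≤-<-trans; <-irrefl; <-trans; <⇒≤; ≮⇒≥; <-cmp; suc-injective)
  renaming (_≟_ to _ℕ-≟_)
open import Data.Product using (Σ-syntax; ∃-syntax; ∃!; _×_; _,_; proj₁; proj₂)
open import Data.Sum using (_⊎_; inj₁; inj₂)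
open import Data.Unit using (tt)
open import Function using (_∘_; Inverse; flip)
open import Function.Structures using (IsBijection)
open import Induction.WellFounded using (WellFounded)
open import Level using (0ℓ)
open import Relation.Binary using (Setoid; IsEquivalence; tri<; tri≈; tri>)
import Relation.Binary.Construct.Closure.Equivalence as EqC
open import Relation.Binary.Construct.Closure.ReflexiveTransitive using (ε; _◅_; _◅◅_)
open import Relation.Binary.Construct.Closure.Symmetric using (fwd; bwd)
import Relation.Binary.Construct.Closure.Transitive as Plus
open Plus using (TransClosure; [_]; _∷_)
open import Relation.Binary.PropositionalEquality
open import Relation.Nullary using (¬_; Dec; yes; no; does)
open import Relation.Nullary.Decidable using (_×-dec_; dec-true; dec-false)
open import Relation.Unary using (Decidable)
open import Algebra.Properties.CommutativeMonoid.Sum +-0-commutativeMonoid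
  using (sum; sum-permute; sum-cong-≗)
open import Algebra.Properties.CommutativeSemigroup +-commutativeSemigroup using (x∙yz≈y∙xz)

-- Iteration and orbits

-- The obstacle is that an isomorphism of nebulas commutes with the cut involution, which fixes
-- every bud and so forgets which halves belonged together. Everything is therefore routed through
-- one relation, `Closes`, which is defined from the word alone and is preserved by every
-- isomorphism. In an opening, `closes-tree` identifies it with the edge involution of C on A, which
-- gives injectivity. In an arbitrary nebula it defines the involution `τ` that glues the buds,
-- which gives surjectivity.
--
-- The bound k ≥ 2 enters through `next-≢`: the two ends of an edge have different types, so an edge
-- of type t required at a vertex of type t must start there. This directs every edge of A towards
-- v₀.
--
-- Types and heights are tied by the same three local rules: an opening raises the height by one and
-- lowers the type by one, a closing does the reverse, and anything else keeps both.

least : {P : ℕ → Set} → Decidable P → ∀ {n} → P n →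
        ∃[ m ] P m × (∀ {j} → j < m → ¬ P j)
least {P} P? {n} = go (<-wellFounded n)
  where
  go : ∀ {n} → Acc _<_ n → P n → ∃[ m ] P m × (∀ {j} → j < m → ¬ P j)
  go {n} (acc rs) Pn with anyUpTo? P? n
  ... | yes (j , j<n , Pj) = go (rs j<n) Pj
  ... | no ¬∃ = n , Pn , λ j<n Pj → ¬∃ (_ , j<n , Pj)

module _ {A : Set} (f : A → A) where

  iterate-+ : ∀ x m n → iterate f x (m + n) ≡ iterate f (iterate f x m) n
  iterate-+ x zero    n = refl
  iterate-+ x (suc m) n = iterate-+ (f x) m n

  iterate-suc : ∀ x n → iterate f x (suc n) ≡ f (iterate f x n)
  iterate-suc x zero    = refl
  iterate-suc x (suc n) = iterate-suc (f x) n

  iterate-periodic : ∀ {x m} → iterate f x m ≡ x →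
                     ∀ c r → iterate f x (c * m + r) ≡ iterate f x r
  iterate-periodic             eq zero    r = refl
  iterate-periodic {x} {m} eq (suc c) r = begin
    iterate f x (m + c * m + r)             ≡⟨ cong (iterate f x) (+-assoc m (c * m) r) ⟩
    iterate f x (m + (c * m + r))           ≡⟨ iterate-+ x m (c * m + r) ⟩
    iterate f (iterate f x m) (c * m + r)   ≡⟨ cong (λ y → iterate f y (c * m + r)) eq ⟩
    iterate f x (c * m + r)                 ≡⟨ iterate-periodic eq c r ⟩
    iterate f x r                           ∎
    where open ≡-Reasoning

  iterate-% : ∀ {x m} → iterate f x (suc m) ≡ x →
              ∀ i → iterate f x (i % suc m) ≡ iterate f x i
  iterate-% {x} {m} eq i = begin
    iterate f x (i % suc m)                        ≡⟨ iterate-periodic eq (i / suc m) (i % suc m) ⟨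
    iterate f x (i / suc m * suc m + i % suc m)    ≡⟨ cong (iterate f x) (+-comm (i / suc m * suc m) _) ⟩
    iterate f x (i % suc m + i / suc m * suc m)    ≡⟨ cong (iterate f x) (m≡m%n+[m/n]*n i (suc m)) ⟨
    iterate f x i                                  ∎
    where open ≡-Reasoning

permutation-injective : ∀ {m n} (π : Permutation m n) {x y} → π ⟨$⟩ʳ x ≡ π ⟨$⟩ʳ y → x ≡ y
permutation-injective π eq = trans (sym (inverseˡ π)) (trans (cong (π ⟨$⟩ˡ_) eq) (inverseˡ π))

sameOrbit-map : ∀ {m n} {f : Fin m → Fin m} {g : Fin n → Fin n} (h : Fin m → Fin n) →
                (∀ x → h (f x) ≡ g (h x)) →
                ∀ {x y} → SameOrbit f x y → SameOrbit g (h x) (h y)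
sameOrbit-map h hf = EqC.gmap h (λ {x} eq → trans (sym (hf x)) (cong h eq))

sameOrbit-sym : ∀ {n} {f : Fin n → Fin n} {x y} → SameOrbit f x y → SameOrbit f y x
sameOrbit-sym {f = f} = EqC.symmetric (Steps f)

sameOrbit-constant : ∀ {n} {A : Set} {f : Fin n → Fin n} (h : Fin n → A) →
                     (∀ x → h (f x) ≡ h x) → ∀ {x y} → SameOrbit f x y → h x ≡ h y
sameOrbit-constant h inv = EqC.gfold isEquivalence h (λ {x} eq → trans (sym (inv x)) (cong h eq))

step : ∀ {n} {f : Fin n → Fin n} {x y} → f x ≡ y → SameOrbit f x y
step eq = fwd eq ◅ ε

iterate⇒sameOrbit : ∀ {n} {f : Fin n → Fin n} x m → SameOrbit f x (iterate f x m)
iterate⇒sameOrbit x zero    = ε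
iterate⇒sameOrbit x (suc m) = fwd refl ◅ iterate⇒sameOrbit _ m

module FiniteOrbits {n : ℕ} {f : Fin n → Fin n} (f-injective : ∀ {x y} → f x ≡ f y → x ≡ y) where

  iterate-injective : ∀ m {x y} → iterate f x m ≡ iterate f y m → x ≡ y
  iterate-injective zero    eq = eq
  iterate-injective (suc m) eq = f-injective (iterate-injective m eq)

  iterate-collision : ∀ x {i j} → i < j → iterate f x i ≡ iterate f x j →
                      ∃[ m ] m < j × iterate f x (suc m) ≡ x
  iterate-collision x {i} {j} i<j eq with o , refl ← m≤n⇒∃[o]m+o≡n i<j =
    o , s≤s (m≤n+m o i) , sym (iterate-injective i (begin
      iterate f x i                         ≡⟨ eq ⟩
      iterate f x (suc (i + o))             ≡⟨ cong (iterate f x ∘ suc) (+-comm i o) ⟩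
      iterate f x (suc (o + i))             ≡⟨ iterate-+ f x (suc o) i ⟩
      iterate f (iterate f x (suc o)) i     ∎))
    where open ≡-Reasoning

  abstract
    period : ∀ x → ∃[ m ] iterate f x (suc m) ≡ x
    period x =
      let i , j , i<j , eq = pigeonhole (n<1+n n) (λ i → iterate f x (toℕ i))
          m , _ , eq′ = iterate-collision x i<j eq
      in m , eq′

    sameOrbit⇒iterate : ∀ {x y} → SameOrbit f x y → ∃[ i ] iterate f x i ≡ y
    sameOrbit⇒iterate ε = 0 , refl
    sameOrbit⇒iterate (fwd refl ◅ s) = let i , eq = sameOrbit⇒iterate s in suc i , eq
    -- A backward step from `f z` to `z` is replaced by the `m` forward steps that complete the
    -- cycle through `z`.
    sameOrbit⇒iterate (_◅_ {j = z} (bwd refl) s) =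
      let m , per = period z
          i , eq  = sameOrbit⇒iterate s
      in m + i , trans (iterate-+ f (f z) m i) (trans (cong (λ u → iterate f u i) per) eq)

  sameOrbit? : ∀ x y → Dec (SameOrbit f x y)
  sameOrbit? x y with m , per ← period x
    with any? {n = suc m} (λ i → iterate f x (toℕ i) ≟ y)
  ... | yes (i , refl) = yes (iterate⇒sameOrbit x (toℕ i))
  ... | no ¬∃ = no λ s → let i , eq = sameOrbit⇒iterate s in
    ¬∃ (i mod suc m , trans (cong (iterate f x) (toℕ-fromℕ< (m%n<n i (suc m))))
                            (trans (iterate-% f per i) eq))

  module Enumeration (transitive : ∀ x y → SameOrbit f x y) (r : Fin n) where

    abstract
      shortest : ∃[ m ] iterate f r (suc m) ≡ r × (∀ {j} → j < m → iterate f r (suc j) ≢ r)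
      shortest = least (λ m → iterate f r (suc m) ≟ r) {proj₁ (period r)} (proj₂ (period r))

    -- One less than the length of the cycle.
    ℓ : ℕ
    ℓ = proj₁ shortest

    iterate-ℓ : iterate f r (suc ℓ) ≡ r
    iterate-ℓ = proj₁ (proj₂ shortest)

    distinct : ∀ {i j} → j < suc ℓ → i < j → iterate f r i ≢ iterate f r j
    distinct j<L i<j eq =
      let m , m<j , per = iterate-collision r i<j eq
      in proj₂ (proj₂ shortest) (<-≤-trans m<j (≤-pred j<L)) per

    index-unique : ∀ (i j : Fin (suc ℓ)) →
                   iterate f r (toℕ i) ≡ iterate f r (toℕ j) → i ≡ j
    index-unique i j eq with <-cmp (toℕ i) (toℕ j)
    ... | tri< i<j _ _ = ⊥-elim (distinct (toℕ<n j) i<j eq)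
    ... | tri≈ _ i≡j _ = toℕ-injective i≡j
    ... | tri> _ _ j<i = ⊥-elim (distinct (toℕ<n i) j<i (sym eq))

    index : Fin n → Fin (suc ℓ)
    index y = proj₁ (sameOrbit⇒iterate (transitive r y)) mod suc ℓ

    iterate-index : ∀ y → iterate f r (toℕ (index y)) ≡ y
    iterate-index y =
      let i , eq = sameOrbit⇒iterate (transitive r y) in
      trans (cong (iterate f r) (toℕ-fromℕ< (m%n<n i (suc ℓ))))
            (trans (iterate-% f iterate-ℓ i) eq)

    index-iterate : ∀ {i} → i < suc ℓ → toℕ (index (iterate f r i)) ≡ i
    index-iterate {i} i<L = trans (cong toℕ (index-unique (index (iterate f r i)) (fromℕ< i<L)
      (trans (iterate-index (iterate f r i)) (cong (iterate f r) (sym (toℕ-fromℕ< i<L))))))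
      (toℕ-fromℕ< i<L)

    enumeration : Permutation (suc ℓ) n
    enumeration = permutation (λ i → iterate f r (toℕ i)) index iterate-index
      (λ i → index-unique _ i (iterate-index _))

-- Words of parentheses written around a cycle
data Status : Set where
  plain opening closing : Status

mirror : Status → Status
mirror plain   = plain
mirror opening = closing
mirror closing = opening

module Word {n : ℕ} (ψ : Fin n → Fin n) (s : Fin n → Status) where

  -- w carries the first unmatched closing parenthesis met on the path
  -- ψ x, ψ (ψ x), …
  data Closes : Fin n → Fin n → Set where
    close : ∀ {x} → s (ψ x) ≡ closing → Closes x (ψ x)
    skip  : ∀ {x w} → s (ψ x) ≡ plain → Closes (ψ x) w → Closes x w
    nest  : ∀ {x y w} → s (ψ x) ≡ opening → Closes (ψ x) y → Closes y w → Closes x w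

  data Balanced : Fin n → Fin n → Set where
    stop : ∀ {x} → Balanced x x
    skip : ∀ {x y} → s (ψ x) ≡ plain → Balanced (ψ x) y → Balanced x y
    jump : ∀ {x y z} → s (ψ x) ≡ opening → Closes (ψ x) y → Balanced y z → Balanced x z

  clash : {A : Set} {a b c : Status} → a ≡ b → a ≡ c → b ≢ c → A
  clash p q b≢c = ⊥-elim (b≢c (trans (sym p) q))

  closes-unique : ∀ {x w w′} → Closes x w → Closes x w′ → w ≡ w′
  closes-unique (close p)    (close q)    = refl
  closes-unique (close p)    (skip q _)   = clash p q λ ()
  closes-unique (close p)    (nest q _ _) = clash p q λ ()
  closes-unique (skip p _)   (close q)    = clash p q λ ()
  closes-unique (skip _ c)   (skip _ d)   = closes-unique c d
  closes-unique (skip p _)   (nest q _ _) = clash p q λ ()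
  closes-unique (nest p _ _) (close q)    = clash p q λ ()
  closes-unique (nest p _ _) (skip q _)   = clash p q λ ()
  closes-unique (nest _ c c′) (nest _ d d′) with refl ← closes-unique c d = closes-unique c′ d′

  closes⇒closing : ∀ {x w} → Closes x w → s w ≡ closing
  closes⇒closing (close p)    = p
  closes⇒closing (skip _ c)   = closes⇒closing c
  closes⇒closing (nest _ _ c) = closes⇒closing c

  closes⇒sameOrbit : ∀ {x w} → Closes x w → SameOrbit ψ x w
  closes⇒sameOrbit (close p)    = step refl
  closes⇒sameOrbit (skip _ c)   = fwd refl ◅ closes⇒sameOrbit c
  closes⇒sameOrbit (nest _ c d) = fwd refl ◅ (closes⇒sameOrbit c ◅◅ closes⇒sameOrbit d)

closes-map : ∀ {m n} {ψ : Fin m → Fin m} {s} {ψ′ : Fin n → Fin n} {s′} (h : Fin m → Fin n) →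
             (∀ x → h (ψ x) ≡ ψ′ (h x)) → (∀ x → s′ (h x) ≡ s x) →
             ∀ {x w} → Word.Closes ψ s x w → Word.Closes ψ′ s′ (h x) (h w)
closes-map {ψ = ψ} {s} {ψ′} {s′} h hψ hs = go
  where
  open Word
  status : ∀ {x c} → s (ψ x) ≡ c → s′ (ψ′ (h x)) ≡ c
  status {x} p = trans (cong s′ (sym (hψ x))) (trans (hs (ψ x)) p)
  go : ∀ {x w} → Closes ψ s x w → Closes ψ′ s′ (h x) (h w)
  go {x} (close p)    = subst (Closes ψ′ s′ (h x)) (sym (hψ x)) (close (status p))
  go {x} (skip p c)   = skip (status p) (subst (λ y → Closes ψ′ s′ y _) (hψ x) (go c))
  go {x} (nest p c d) = nest (status p) (subst (λ y → Closes ψ′ s′ y _) (hψ x) (go c)) (go d)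

module Reversal {n : ℕ} {ψ ψ⁻¹ : Fin n → Fin n} (s : Fin n → Status)
                (ψ⁻¹ψ : ∀ x → ψ⁻¹ (ψ x) ≡ x) where

  open Word ψ s using (close; skip; nest) renaming (Closes to Closes⁺)
  open Word ψ⁻¹ (mirror ∘ s) using () renaming (Closes to Closes⁻)

  private
    retreat : ∀ {x c} → s x ≡ c → mirror (s (ψ⁻¹ (ψ x))) ≡ mirror c
    retreat p = cong mirror (trans (cong s (ψ⁻¹ψ _)) p)

    back : ∀ {x o} → Closes⁻ x o → Closes⁻ (ψ⁻¹ (ψ x)) o
    back = subst (λ y → Closes⁻ y _) (sym (ψ⁻¹ψ _))

  -- Generalisation of `closes-reverse` that makes the induction work: everything strictly between
  -- `x` and `w` is matched, so reading backwards from `w` passes over it and meets what is met from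
  -- `ψ x`. A nested pair is itself reversed by `closes-reverse`, hence the mutual recursion.
  closes-retrace : ∀ {x w o} → Closes⁺ x w → Closes⁻ (ψ x) o → Closes⁻ w o
  closes-reverse : ∀ {o w} → s o ≡ opening → Closes⁺ o w → Closes⁻ w o

  closes-retrace (close _)    e = e
  closes-retrace (skip p c)   e = closes-retrace c (Word.skip (retreat p) (back e))
  closes-retrace {x} (nest p c d) e =
    closes-retrace d (Word.nest (retreat (Word.closes⇒closing ψ s c)) (back (closes-reverse p c)) e)

  closes-reverse {o} p c = closes-retrace c
    (subst (Closes⁻ (ψ o)) (ψ⁻¹ψ o) (Word.close (retreat p)))

mirror-involutive : ∀ c → mirror (mirror c) ≡ c
mirror-involutive plain   = refl
mirror-involutive opening = refl
mirror-involutive closing = refl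

-- Heights along a word and the existence of matching parentheses

Change : Status → ℕ → ℕ → Set
Change plain   a b = a ≡ b
Change opening a b = b ≡ suc a
Change closing a b = a ≡ suc b

change-mirror : ∀ c {a b} → Change c a b → Change (mirror c) b a
change-mirror plain   = sym
change-mirror opening e = e
change-mirror closing e = e

-- `h x` is the height just after `x` has been read, in accordance with `Closes x`, which starts
-- reading at `ψ x`.
module Height {n : ℕ} {ψ : Fin n → Fin n} {s : Fin n → Status} (h : Fin n → ℕ)
              (change : ∀ x → Change (s (ψ x)) (h x) (h (ψ x))) where

  open Word ψ s

  change-as : ∀ {x c} → s (ψ x) ≡ c → Change c (h x) (h (ψ x))
  change-as {x} p = subst (λ c → Change c (h x) (h (ψ x))) p (change x)

  closes-height : ∀ {x w} → Closes x w → h x ≡ suc (h w)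
  closes-height (close p)    = change-as p
  closes-height (skip p c)   = trans (change-as p) (closes-height c)
  closes-height (nest p c d) =
    trans (suc-injective (trans (sym (change-as p)) (closes-height c))) (closes-height d)

  balanced-height : ∀ {x y} → Balanced x y → h x ≡ h y
  balanced-height stop         = refl
  balanced-height (skip p b)   = trans (change-as p) (balanced-height b)
  balanced-height (jump p c b) =
    trans (suc-injective (trans (sym (change-as p)) (closes-height c))) (balanced-height b)

  -- Reading `m` darts leaves an unmatched closing, or an unmatched opening and hence a gain of
  -- height, or neither. The bound on the position of the closing is what allows reading to resume
  -- after a matched pair.
  parse : ∀ m x →
          (∃[ i ] i ≤ m × Closes x (iterate ψ x i))
          ⊎ (h x < h (iterate ψ x m) ⊎ Balanced x (iterate ψ x m))
  parse m = go (<-wellFounded m)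
    where
    go : ∀ {m} → Acc _<_ m → ∀ x →
         (∃[ i ] i ≤ m × Closes x (iterate ψ x i))
         ⊎ (h x < h (iterate ψ x m) ⊎ Balanced x (iterate ψ x m))
    go {zero}  _ x = inj₂ (inj₂ stop)
    go {suc m} (acc rs) x with s (ψ x) in eq
    ... | closing = inj₁ (1 , s≤s z≤n , close eq)
    ... | plain with go (rs ≤-refl) (ψ x)
    ...   | inj₁ (i , i≤m , c) = inj₁ (suc i , s≤s i≤m , skip eq c)
    ...   | inj₂ (inj₁ lt) = inj₂ (inj₁ (≤-<-trans (≤-reflexive (change-as eq)) lt))
    ...   | inj₂ (inj₂ b) = inj₂ (inj₂ (skip eq b))
    go {suc m} (acc rs) x | opening with go (rs ≤-refl) (ψ x)
    ... | inj₂ (inj₁ lt) = inj₂ (inj₁ (<-trans (≤-reflexive (sym (change-as eq))) lt))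
    ... | inj₂ (inj₂ b) =
      inj₂ (inj₁ (≤-reflexive (trans (sym (change-as eq)) (balanced-height b))))
    -- The opening and its match use up `suc i` of the `suc m` darts, and parsing resumes with the
    -- remaining `j`. As `j` is not a subterm of `suc m`, the recursion is on `_<_`.
    ... | inj₁ (i , i≤m , c) with j , refl ← m≤n⇒∃[o]m+o≡n i≤m
      rewrite iterate-+ ψ (ψ x) i j
      with go (rs (s≤s (m≤n+m j i))) (iterate ψ (ψ x) i)
    ...   | inj₂ (inj₁ lt) =
      inj₂ (inj₁ (≤-<-trans (≤-reflexive (balanced-height (jump eq c stop))) lt))
    ...   | inj₂ (inj₂ b) = inj₂ (inj₂ (jump eq c b))
    ...   | inj₁ (l , l≤j , d) = inj₁ (suc (i + l) , s≤s (+-monoʳ-≤ i l≤j) ,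
      nest eq c (subst (Closes _) (sym (iterate-+ ψ (ψ x) i l)) d))

  module _ (ψ-injective : ∀ {x y} → ψ x ≡ ψ y → x ≡ y) where

    closes-or-balanced : ∀ x y → SameOrbit ψ x y → h y ≤ h x →
                         (∃[ w ] Closes x w) ⊎ Balanced x y
    closes-or-balanced x y o hy≤hx
      with m , refl ← FiniteOrbits.sameOrbit⇒iterate ψ-injective o
      with parse m x
    ... | inj₁ (_ , _ , c)    = inj₁ (_ , c)
    ... | inj₂ (inj₁ lt) = ⊥-elim (<-irrefl refl (<-≤-trans lt hy≤hx))
    ... | inj₂ (inj₂ b) = inj₂ b

    closes-exists : ∀ x y → SameOrbit ψ x y → h y < h x → ∃[ w ] Closes x w
    closes-exists x y o hy<hx with closes-or-balanced x y o (<⇒≤ hy<hx)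
    ... | inj₁ c = c
    ... | inj₂ b = ⊥-elim (<-irrefl (sym (balanced-height b)) hy<hx)

-- A height for every cyclic word with as many openings as closings

indicator : Status → Status → ℕ
indicator plain   plain   = 1
indicator opening opening = 1
indicator closing closing = 1
indicator _       _       = 0

module _ {A : Set} (ψ : A → A) where

  count : (A → ℕ) → A → ℕ → ℕ
  count f x zero    = 0
  count f x (suc m) = f x + count f (ψ x) m

  count-suc : ∀ f x m → count f x (suc m) ≡ f (iterate ψ x m) + count f x m
  count-suc f x zero    = refl
  count-suc f x (suc m) = begin
    f x + count f (ψ x) (suc m)                             ≡⟨ cong (f x +_) (count-suc f (ψ x) m) ⟩
    f x + (f (iterate ψ (ψ x) m) + count f (ψ x) m)         ≡⟨ x∙yz≈y∙xz (f x) (f (iterate ψ (ψ x) m)) (count f (ψ x) m) ⟩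
    f (iterate ψ (ψ x) m) + (f x + count f (ψ x) m)         ∎
    where open ≡-Reasoning

  count≡sum : ∀ f x m → count f x m ≡ sum (λ (i : Fin m) → f (iterate ψ x (toℕ i)))
  count≡sum f x zero    = refl
  count≡sum f x (suc m) = cong (f x +_) (count≡sum f (ψ x) m)

module ConstructHeight {n : ℕ} (π : Permutation n n) (s : Fin n → Status)
  (transitive : ∀ x y → SameOrbit (π ⟨$⟩ʳ_) x y) (r : Fin n)
  (balanced : sum (indicator opening ∘ s) ≡ sum (indicator closing ∘ s)) where

  private
    ψ = π ⟨$⟩ʳ_

  open FiniteOrbits (permutation-injective π)
  open Enumeration transitive r

  openings closings : Fin n → ℕ
  openings = indicator opening ∘ s
  closings = indicator closing ∘ s

  -- Openings met so far plus closings still to come, i steps after r.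
  profile : ℕ → ℕ
  profile i = count ψ openings (ψ r) i + count ψ closings (iterate ψ (ψ r) i) (suc ℓ ∸ i)

  -- Openings minus closings read since `r`, shifted by the total number of closings. Counting the
  -- closings still to come, rather than subtracting those already met, keeps the height in ℕ.
  height : Fin n → ℕ
  height x = profile (toℕ (index x))

  count-cycle : ∀ f → count ψ f (ψ r) (suc ℓ) ≡ sum f
  count-cycle f = begin
    count ψ f (ψ r) (suc ℓ)                              ≡⟨ count≡sum ψ f (ψ r) (suc ℓ) ⟩
    sum {suc ℓ} (λ i → f (iterate ψ (ψ r) (toℕ i)))              ≡⟨ sum-cong-≗ {suc ℓ} (λ i → cong f (iterate-suc ψ r (toℕ i))) ⟩
    sum {suc ℓ} (λ i → f (ψ (enumeration ⟨$⟩ʳ i)))               ≡⟨ sum-permute f (enumeration ∘ₚ π) ⟨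
    sum f                                                ∎
    where open ≡-Reasoning

  -- After a full turn every opening has been met and no closing is to come; at the start it is the
  -- other way round. This is where the balance of the word is used: it makes the height well
  -- defined on the cycle.
  profile-wrap : profile (suc ℓ) ≡ profile 0
  profile-wrap = begin
    count ψ openings (ψ r) (suc ℓ) + count ψ closings (iterate ψ (ψ r) (suc ℓ)) (suc ℓ ∸ suc ℓ)
      ≡⟨ cong (λ o → count ψ openings (ψ r) (suc ℓ) + count ψ closings (iterate ψ (ψ r) (suc ℓ)) o) (n∸n≡0 (suc ℓ)) ⟩
    count ψ openings (ψ r) (suc ℓ) + 0   ≡⟨ +-identityʳ _ ⟩
    count ψ openings (ψ r) (suc ℓ)       ≡⟨ count-cycle openings ⟩
    sum openings                         ≡⟨ balanced ⟩
    sum closings                         ≡⟨ count-cycle closings ⟨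
    count ψ closings (ψ r) (suc ℓ)       ∎
    where open ≡-Reasoning

  change-indicators : ∀ c a b → Change c (a + (indicator closing c + b)) (indicator opening c + a + b)
  change-indicators plain   a b = refl
  change-indicators opening a b = refl
  change-indicators closing a b = +-suc a b

  profile-change : ∀ {i} → i < suc ℓ →
                   Change (s (iterate ψ (ψ r) i)) (profile i) (profile (suc i))
  profile-change {i} i<L = subst₂ (Change (s y)) (sym before) (sym after)
    (change-indicators (s y) (count ψ openings (ψ r) i) (count ψ closings (ψ y) (suc ℓ ∸ suc i)))
    where
    y = iterate ψ (ψ r) i
    before : profile i ≡ count ψ openings (ψ r) i + (closings y + count ψ closings (ψ y) (suc ℓ ∸ suc i))
    before = cong (λ m → count ψ openings (ψ r) i + count ψ closings y m) (+-∸-assoc 1 (≤-pred i<L))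
    after : profile (suc i) ≡ openings y + count ψ openings (ψ r) i + count ψ closings (ψ y) (suc ℓ ∸ suc i)
    after = cong₂ _+_ (count-suc ψ openings (ψ r) i)
                      (cong (λ z → count ψ closings z (suc ℓ ∸ suc i)) (iterate-suc ψ (ψ r) i))

  change : ∀ x → Change (s (ψ x)) (height x) (height (ψ x))
  change x = subst₂ (λ y b → Change (s y) (height x) b) next-dart (sym next-height) (profile-change i<L)
    where
    i = toℕ (index x)
    i<L = toℕ<n (index x)
    next-dart : iterate ψ (ψ r) i ≡ ψ x
    next-dart = trans (iterate-suc ψ r i) (cong ψ (iterate-index x))
    next-height : height (ψ x) ≡ profile (suc i)
    next-height with m≤n⇒m<n∨m≡n i<L
    ... | inj₁ lt = cong profile (trans (cong (toℕ ∘ index) (sym next-dart)) (index-iterate lt))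
    -- `x` is the last dart of the cycle, so the index of `ψ x` drops back to 0 and `profile-wrap`
    -- is needed.
    ... | inj₂ eq = begin
      profile (toℕ (index (ψ x)))  ≡⟨ cong (profile ∘ toℕ ∘ index) wrap ⟩
      profile (toℕ (index r))      ≡⟨ cong profile (index-iterate {0} (s≤s z≤n)) ⟩
      profile 0                    ≡⟨ profile-wrap ⟨
      profile (suc ℓ)              ≡⟨ cong profile eq ⟨
      profile (suc i)              ∎
      where
      open ≡-Reasoning
      wrap : ψ x ≡ r
      wrap = trans (sym next-dart) (trans (cong (iterate ψ r) eq) iterate-ℓ)

-- Types, sizes and rotation systems

next-cases : ∀ {n} (i : Fin (suc n)) →
             (toℕ i < n × toℕ (next i) ≡ suc (toℕ i)) ⊎ (toℕ i ≡ n × toℕ (next i) ≡ 0)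
next-cases {n} i with m≤n⇒m<n∨m≡n (≤-pred (toℕ<n i))
... | inj₁ i<n = inj₁ (i<n ,
  trans (toℕ-fromℕ< (m%n<n (suc (toℕ i)) (suc n))) (m<n⇒m%n≡m (s≤s i<n)))
... | inj₂ i≡n = inj₂ (i≡n ,
  trans (toℕ-fromℕ< (m%n<n (suc (toℕ i)) (suc n)))
        (trans (cong (λ m → suc m % suc n) i≡n) (n%n≡0 (suc n))))

next-injective : ∀ {k} {s t : Fin k} → next s ≡ next t → s ≡ t
next-injective {suc k} {s} {t} eq with next-cases s | next-cases t
... | inj₁ (_ , p) | inj₁ (_ , q) =
  toℕ-injective (suc-injective (trans (sym p) (trans (cong toℕ eq) q)))
... | inj₁ (_ , p) | inj₂ (_ , q) with () ← trans (sym p) (trans (cong toℕ eq) q)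
... | inj₂ (_ , p) | inj₁ (_ , q) with () ← trans (sym q) (trans (cong toℕ (sym eq)) p)
... | inj₂ (p , _) | inj₂ (q , _) = toℕ-injective (trans p (sym q))

next-≢ : ∀ {k} → 2 ≤ k → (t : Fin k) → next t ≢ t
next-≢ {suc k} 2≤k t eq with next-cases t
... | inj₁ (_ , p) = <-irrefl (trans (cong toℕ (sym eq)) p) (n<1+n (toℕ t))
... | inj₂ (p , q) with refl ← trans (sym p) (trans (cong toℕ (sym eq)) q)
  with s≤s () ← 2≤k

hasSize : (S : Setoid 0ℓ 0ℓ) → let open Setoid S using (Carrier; _≈_) in
          ∀ {m} (to : Fin m → Carrier) → (∀ {i j} → to i ≈ to j → i ≡ j) →
          (∀ y → ∃[ i ] to i ≈ y) → S HasSize m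
hasSize S to inj sur = record
  { to        = to
  ; from      = from
  ; to-cong   = λ { refl → S.refl }
  ; from-cong = λ {x} {y} x≈y → inj (S.trans (to-from x) (S.trans x≈y (S.sym (to-from y))))
  ; inverse   = (λ { {x} refl → to-from x }) ,
                λ {i} {y} y≈ → inj (S.trans (to-from y) y≈)
  }
  where
  module S = Setoid S
  from : S.Carrier → Fin _
  from y = proj₁ (sur y)
  to-from : ∀ y → to (from y) S.≈ y
  to-from y = proj₂ (sur y)

module HasSize (S : Setoid 0ℓ 0ℓ) {m : ℕ} (e : S HasSize m) where
  open Setoid S using (_≈_)
  open Inverse e using (to; from)

  element-surjective : ∀ y → ∃[ i ] to i ≈ y
  element-surjective y = from y , Inverse.inverseˡ e refl

  element-injective : ∀ {i j} → to i ≈ to j → i ≡ j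
  element-injective eq = trans (sym (Inverse.inverseʳ e (Setoid.refl S))) (Inverse.inverseʳ e eq)

other : Colour → Colour
other black = white
other white = black

≢⇒other : ∀ {c c′ : Colour} → c′ ≢ c → c′ ≡ other c
≢⇒other {black} {black} ne = ⊥-elim (ne refl)
≢⇒other {black} {white} ne = refl
≢⇒other {white} {black} ne = refl
≢⇒other {white} {white} ne = ⊥-elim (ne refl)

-- The type of the constellation vertex from which a dart of the given colour
-- leaves along an edge of type t.
sourceType : ∀ {k} → Colour → Fin k → Fin k
sourceType black t = t
sourceType white t = next t

budStatus : Colour → Status
budStatus black = opening
budStatus white = closing

module Rotation (M : RotationSystem) where
  open RotationSystem M

  σ-injective : ∀ {x y} → σ ⟨$⟩ʳ x ≡ σ ⟨$⟩ʳ y → x ≡ y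
  σ-injective = permutation-injective σ

  sameEdge-cases : ∀ {d e} → SameEdge d e → e ≡ d ⊎ e ≡ α d
  sameEdge-cases ε = inj₁ refl
  sameEdge-cases (fwd refl ◅ s) with sameEdge-cases s
  ... | inj₁ eq = inj₂ eq
  ... | inj₂ eq = inj₁ (trans eq (α-involutive _))
  sameEdge-cases (bwd refl ◅ s) with sameEdge-cases s
  ... | inj₁ eq = inj₂ (trans eq (sym (α-involutive _)))
  ... | inj₂ eq = inj₁ eq

  singleFace⇒connected : (∀ d e → SameFace d e) → Connected
  singleFace⇒connected single d e = EqC.fold (EqC.isEquivalence _)
    (λ { {x} refl → fwd (inj₂ (tt , refl)) ◅ fwd (inj₁ (bwd (inverseʳ σ) ◅ ε)) ◅ ε })
    (single d e)

  -- The face traversal φ, conjugated by α.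
  turn : Permutation size size
  turn = permutation (λ d → α (σ ⟨$⟩ˡ d)) (λ d → σ ⟨$⟩ʳ α d)
    (λ d → trans (cong α (inverseˡ σ)) (α-involutive d))
    (λ d → trans (cong (σ ⟨$⟩ʳ_) (α-involutive _)) (inverseʳ σ))

  singleFace⇒transitive : (∀ d e → SameFace d e) → ∀ x y → SameOrbit (turn ⟨$⟩ʳ_) x y
  singleFace⇒transitive single x y =
    subst₂ (SameOrbit (turn ⟨$⟩ʳ_)) (α-involutive x) (α-involutive y)
      (sameOrbit-map α (λ _ → refl) (single (α x) (α y)))

  transitive⇒singleFace : (∀ x y → SameOrbit (turn ⟨$⟩ʳ_) x y) → ∀ d e → SameFace d e
  transitive⇒singleFace tr d e =
    subst₂ SameFace (α-involutive d) (α-involutive e)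
      (sameOrbit-map α (λ x → trans (α-involutive _) (cong (σ ⟨$⟩ˡ_) (sym (α-involutive x))))
        (tr (α d) (α e)))

-- The word of buds around the face of a nebula

module BudWord {k : ℕ} (N : RootedBudMap k) where
  open RootedBudMap N
  open Rotation system public

  ψ : Dart → Dart
  ψ = turn ⟨$⟩ʳ_

  status : Dart → Status
  status d = if does (α d ≟ d) then budStatus (vertexColour d) else plain

  status-bud : ∀ {d} → IsBud d → status d ≡ budStatus (vertexColour d)
  status-bud {d} bud rewrite dec-true (α d ≟ d) bud = refl

  status-edge : ∀ {d} → ¬ IsBud d → status d ≡ plain
  status-edge {d} edge rewrite dec-false (α d ≟ d) edge = refl

  opening-bud : ∀ {d} → IsBud d → vertexColour d ≡ black → status d ≡ opening
  opening-bud bud eq = trans (status-bud bud) (cong budStatus eq)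

  closing-bud : ∀ {d} → IsBud d → vertexColour d ≡ white → status d ≡ closing
  closing-bud bud eq = trans (status-bud bud) (cong budStatus eq)

  open Word ψ status public

  opening⇒ : ∀ {d} → status d ≡ opening → IsBud d × vertexColour d ≡ black
  opening⇒ {d} eq with α d ≟ d | vertexColour d
  ... | yes bud | black = bud , refl

  closing⇒ : ∀ {d} → status d ≡ closing → IsBud d × vertexColour d ≡ white
  closing⇒ {d} eq with α d ≟ d | vertexColour d
  ... | yes bud | white = bud , refl

  plain⇒ : ∀ {d} → status d ≡ plain → ¬ IsBud d
  plain⇒ {d} eq with α d ≟ d | vertexColour d
  plain⇒ () | yes bud | black
  plain⇒ () | yes bud | white
  ... | no edge | _ = edge

module Constellation {k : ℕ} (C : RootedConstellation k) where
  open RootedConstellation C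
  open Rotation system public

  colour-α : ∀ d → faceColour (α d) ≡ other (faceColour d)
  colour-α d = ≢⇒other (separates d)

  α-white : ∀ {d} → faceColour d ≡ black → faceColour (α d) ≡ white
  α-white {d} eq = trans (colour-α d) (cong other eq)

  α-black : ∀ {d} → faceColour d ≡ white → faceColour (α d) ≡ black
  α-black {d} eq = trans (colour-α d) (cong other eq)

  edgeType-black : ∀ {d} → faceColour d ≡ black → edgeType d ≡ vertexType d
  edgeType-black {d} eq with faceColour d
  ... | black = refl

  edgeType-white : ∀ {d} → faceColour d ≡ white → edgeType d ≡ vertexType (α d)
  edgeType-white {d} eq with faceColour d
  ... | white = refl

  vertexType-head : ∀ {d} → faceColour d ≡ black → vertexType (α d) ≡ next (vertexType d)
  vertexType-head {d} eq = begin
    vertexType (α d)           ≡⟨ cong vertexType (inverseʳ σ) ⟨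
    vertexType (σ ⟨$⟩ʳ φ d)    ≡⟨ vertexType-σ (φ d) ⟩
    vertexType (φ d)           ≡⟨ black-types d eq ⟩
    next (vertexType d)        ∎
    where open ≡-Reasoning

  -- A white dart leaves the head of its edge, whence the `next`. Vertex types are thus determined
  -- by colours and edge types, which the nebula retains.
  vertexType-source : ∀ d → vertexType d ≡ sourceType (faceColour d) (edgeType d)
  vertexType-source d with faceColour d in eq
  ... | black = refl
  ... | white = trans (cong vertexType (sym (α-involutive d))) (vertexType-head (α-black eq))

  sameVertex⇒vertexType : ∀ {v w} → SameVertex v w → vertexType v ≡ vertexType w
  sameVertex⇒vertexType = sameOrbit-constant vertexType vertexType-σ

-- From tree-pointed constellations to nebulas

module Opening {k : ℕ} (2≤k : 2 ≤ k) {p : Fin k → ℕ} (X : TreePointed p) where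
  open TreePointed X
  open Constellation constellation
  open BudWord (treeOpening X) using
    (ψ; status; opening-bud; closing-bud; status-edge; Closes; close; skip; nest; closes⇒sameOrbit)
  private
    module N = RootedBudMap (treeOpening X)

  v₀ : Dart
  v₀ = proj₁ arborescence

  q : Fin k → ℕ
  q = proj₁ (proj₂ arborescence)

  open IsArborescence (proj₁ (proj₂ (proj₂ arborescence)))
  open IsSpanningTree spanning-tree renaming (connected to tree-connected)

  vertex-counts : HasVertexCounts q
  vertex-counts = proj₁ (proj₂ (proj₂ (proj₂ arborescence)))

  count-root : q (vertexType v₀) ≡ suc (p (vertexType v₀))
  count-root = proj₁ (proj₂ (proj₂ (proj₂ (proj₂ arborescence))))

  count-other : ∀ s → s ≢ vertexType v₀ → q s ≡ p s
  count-other = proj₂ (proj₂ (proj₂ (proj₂ (proj₂ arborescence))))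

  member⇒bud : ∀ {d} → member d ≡ true → N.IsBud d
  member⇒bud eq rewrite eq = refl

  bud⇒member : ∀ {d} → N.IsBud d → member d ≡ true
  bud⇒member {d} bud with member d
  ... | true  = refl
  ... | false = ⊥-elim (no-buds d bud)

  edge-α : ∀ {d} → member d ≡ false → N.α d ≡ α d
  edge-α eq rewrite eq = refl

  -- Edges of the tree, represented by their black dart, which is directed
  -- towards v₀.
  Out : Dart → Set
  Out e = member e ≡ true × faceColour e ≡ black

  sameVertex? : ∀ x y → Dec (SameVertex x y)
  sameVertex? = FiniteOrbits.sameOrbit? σ-injective

  out-sameEdge : ∀ {e e′} → Out e → Out e′ → SameEdge e e′ → e ≡ e′
  out-sameEdge (_ , b) (_ , b′) s with sameEdge-cases s
  ... | inj₁ eq   = sym eq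
  ... | inj₂ refl with () ← trans (sym b′) (α-white b)

  out-unique′ : ∀ {e e′} → Out e → Out e′ → ¬ SameVertex e v₀ → SameVertex e e′ → e ≡ e′
  out-unique′ {e} {e′} o@(m , b) o′@(m′ , b′) e≁v₀ s =
    let _ , _ , unique = unique-edge e e≁v₀
        x~e  = unique (m , edgeType-black b , inj₁ ε)
        x~e′ = unique (m′ , trans (edgeType-black b′) (sym (sameVertex⇒vertexType s)) , inj₁ s)
    in out-sameEdge o o′ (sameOrbit-sym x~e ◅◅ x~e′)

  -- The edge given by `unique-edge` has the type of `v`. If `v` were its head, the type of `v`
  -- would be its own `next`; so `v` is its tail, where the black dart of the edge starts.
  out-exists′ : ∀ {v} → ¬ SameVertex v v₀ → ∃[ e ] Out e × SameVertex v e
  out-exists′ {v} v≁v₀ with unique-edge v v≁v₀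
  ... | x , (m , t , inc) , _ with faceColour x in eq | inc
  ...   | black | inj₁ s = x , (m , eq) , s
  ...   | black | inj₂ s = ⊥-elim (next-≢ 2≤k (vertexType v)
    (trans (cong next (sym t)) (trans (sym (vertexType-head eq)) (sym (sameVertex⇒vertexType s)))))
  ...   | white | inj₂ s = α x , (trans (member-α x) m , α-black eq) , s
  ...   | white | inj₁ s = ⊥-elim (next-≢ 2≤k (vertexType v)
    (trans (cong next (sym t)) (trans (sym (vertexType-head (α-black eq)))
      (trans (cong vertexType (α-involutive x)) (sym (sameVertex⇒vertexType s))))))

  infix 4 _⊲_

  -- The edge e leads from a child of the vertex at which e′ starts.
  _⊲_ : Dart → Dart → Set
  e ⊲ e′ = Out e × Out e′ × SameVertex (α e) e′

  record ClosedWalk (n : ℕ) : Set where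
    field
      dart        : ℕ → Dart
      out         : ∀ i → Out (dart i)
      consecutive : ∀ {i} → i < n → SameVertex (α (dart i)) (dart (suc i))
      closed      : SameVertex (α (dart n)) (dart 0)

  -- A closed walk with a repeated vertex contains a shorter one, and a closed walk without
  -- repetition is a `Cycle` of the tree. Its edges are distinct because distinct `Out` darts lie on
  -- distinct edges.
  no-closedWalk : ∀ {n} → ¬ ClosedWalk n
  no-closedWalk {n} = go (<-wellFounded n)
    where
    go : ∀ {n} → Acc _<_ n → ¬ ClosedWalk n
    go {n} (acc rs) W with any? {n = suc n} (λ i → any? {n = suc n} (λ j →
      (toℕ i <? toℕ j) ×-dec sameVertex? (ClosedWalk.dart W (toℕ i)) (ClosedWalk.dart W (toℕ j))))
    -- The shorter walk uses the darts `i` to `i + o`, the last one before `j`; it closes up because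
    -- `i` and `j` start at the same vertex.
    ... | yes (i , j , i<j , s) with o , eq ← m≤n⇒∃[o]m+o≡n i<j =
      go (rs (<-≤-trans (subst (o <_) eq (s≤s (m≤n+m o (toℕ i)))) (≤-pred (toℕ<n j)))) record
        { dart        = λ l → W.dart (toℕ i + l)
        ; out         = λ l → W.out (toℕ i + l)
        ; consecutive = λ {l} l<o → subst (λ l′ → SameVertex (α (W.dart (toℕ i + l))) (W.dart l′))
            (sym (+-suc (toℕ i) l)) (W.consecutive (within l (<⇒≤ l<o)))
        ; closed      =
            subst (λ l → SameVertex (α (W.dart (toℕ i + o))) (W.dart l)) eq
              (W.consecutive (within o ≤-refl))
             ◅◅ subst (λ l′ → SameVertex (W.dart (toℕ j)) (W.dart l′)) (sym (+-identityʳ (toℕ i)))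
                  (sameOrbit-sym s)
        }
      where
      module W = ClosedWalk W
      within : ∀ l → l ≤ o → toℕ i + l < n
      within l l≤o = <-≤-trans (subst (toℕ i + l <_) eq (s≤s (+-monoʳ-≤ (toℕ i) l≤o))) (≤-pred (toℕ<n j))
    ... | no simple = acyclic record
        { dart              = dart
        ; in-set            = λ i → proj₁ (W.out (toℕ i))
        ; consecutive       = consecutive
        ; distinct-vertices = distinct
        ; distinct-edges    = λ i j s → distinct i j
            (subst (SameVertex (dart i)) (out-sameEdge (W.out (toℕ i)) (W.out (toℕ j)) s) ε)
        }
      where
      module W = ClosedWalk W
      dart : Fin (suc n) → Dart
      dart i = W.dart (toℕ i)
      consecutive : ∀ i → SameVertex (α (dart i)) (dart (next i))
      consecutive i with next-cases i
      ... | inj₁ (i<n , eq) rewrite eq = W.consecutive i<n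
      ... | inj₂ (i≡n , eq) rewrite i≡n | eq = W.closed
      distinct : ∀ i j → SameVertex (dart i) (dart j) → i ≡ j
      distinct i j s with <-cmp (toℕ i) (toℕ j)
      ... | tri< i<j _ _ = ⊥-elim (simple (i , j , i<j , s))
      ... | tri≈ _ eq _  = toℕ-injective eq
      ... | tri> _ _ j<i = ⊥-elim (simple (j , i , j<i , sameOrbit-sym s))

  closedWalk : ∀ {e e′} → TransClosure _⊲_ e e′ →
               ∃[ n ] Σ[ dart ∈ (ℕ → Dart) ] dart 0 ≡ e × (∀ i → Out (dart i))
                 × (∀ {i} → i < n → SameVertex (α (dart i)) (dart (suc i)))
                 × SameVertex (α (dart n)) e′
  closedWalk {e} [ o , _ , s ] = 0 , (λ _ → e) , refl , (λ _ → o) , (λ ()) , s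
  closedWalk {e} ((o , _ , s) ∷ c) =
    let n , dart , start , out , consecutive , end = closedWalk c in
    suc n , (λ { zero → e ; (suc i) → dart i }) , refl ,
    (λ { zero → o ; (suc i) → out i }) ,
    (λ { {zero} _ → subst (SameVertex (α e)) (sym start) s ; {suc i} (s≤s i<n) → consecutive i<n }) ,
    end

  ⊲⁺-irreflexive : ∀ {e} → ¬ TransClosure _⊲_ e e
  ⊲⁺-irreflexive c =
    let n , dart , start , out , consecutive , end = closedWalk c in
    no-closedWalk record
      { dart = dart ; out = out ; consecutive = consecutive
      ; closed = subst (SameVertex (α (dart n))) (sym start) end }

  ⊲-wellFounded : WellFounded _⊲_
  ⊲-wellFounded = Plus.wellFounded⁻ _⊲_ (spo-wellFounded {_≈_ = _≡_} record
    { isEquivalence = isEquivalence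
    ; irrefl        = λ { refl → ⊲⁺-irreflexive }
    ; trans         = Plus.transitive _⊲_
    ; <-resp-≈      = resp₂ (TransClosure _⊲_)
    })

  ⊳⁺-wellFounded : WellFounded (flip (TransClosure _⊲_))
  ⊳⁺-wellFounded = spo-wellFounded {_≈_ = _≡_} record
    { isEquivalence = isEquivalence
    ; irrefl        = λ { refl → ⊲⁺-irreflexive }
    ; trans         = λ b a → Plus.transitive _⊲_ a b
    ; <-resp-≈      = resp₂ (flip (TransClosure _⊲_))
    }

  -- Otherwise every vertex would have an outgoing edge, and following them
  -- would never stop.
  no-out-at-root : ∀ {e} → Out e → ¬ SameVertex e v₀
  no-out-at-root {e} o s = go (⊳⁺-wellFounded e) o
    where
    exists : ∀ v → ∃[ e ] Out e × SameVertex v e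
    exists v with sameVertex? v v₀
    ... | yes r = e , o , r ◅◅ sameOrbit-sym s
    ... | no ¬r = out-exists′ ¬r
    go : ∀ {x} → Acc (flip (TransClosure _⊲_)) x → ¬ Out x
    go {x} (acc rs) ox =
      let y , oy , xy = exists (α x)
      in go (rs [ ox , oy , xy ]) oy

  out-unique : ∀ {e e′} → Out e → Out e′ → SameVertex e e′ → e ≡ e′
  out-unique o o′ = out-unique′ o o′ (no-out-at-root o)

  -- The inverse rotation of the dual is `α` after `σ`, and the cut involution undoes this `α`
  -- exactly off the tree. Hence `ψ` turns around a vertex of the constellation until the next dart
  -- lies in the tree, and then crosses that edge: this is the contour of the tree.
  ψ-tree : ∀ {x} → member (σ ⟨$⟩ʳ x) ≡ true → ψ x ≡ α (σ ⟨$⟩ʳ x)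
  ψ-tree {x} eq rewrite trans (member-α (σ ⟨$⟩ʳ x)) eq = refl

  ψ-other : ∀ {x} → member (σ ⟨$⟩ʳ x) ≡ false → ψ x ≡ σ ⟨$⟩ʳ x
  ψ-other {x} eq rewrite trans (member-α (σ ⟨$⟩ʳ x)) eq = α-involutive _

  status-other : ∀ {d} → member d ≡ false → status d ≡ plain
  status-other eq = status-edge (λ bud → case (trans (sym eq) (bud⇒member bud)))
    where
    case : false ≢ true
    case ()

  data Corner (d : Dart) : Set where
    inside : member d ≡ false → Corner d
    up     : Out d → Corner d
    down   : Out (α d) → Corner d

  corner : ∀ d → Corner d
  corner d with member d in m | faceColour d in c
  ... | false | _     = inside m
  ... | true  | black = up (m , c)
  ... | true  | white = down (trans (member-α d) m , α-black c)

  closes-up : ∀ {x} → Out (σ ⟨$⟩ʳ x) → Closes x (α (σ ⟨$⟩ʳ x))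
  closes-up {x} (m , c) = subst (Closes x) (ψ-tree m) (close (closing-bud
    (member⇒bud (trans (cong member (ψ-tree m)) (trans (member-α _) m)))
    (trans (cong faceColour (ψ-tree m)) (α-white c))))

  closes-inside : ∀ {x w} → member (σ ⟨$⟩ʳ x) ≡ false → Closes (σ ⟨$⟩ʳ x) w → Closes x w
  closes-inside m c = skip (trans (cong status (ψ-other m)) (status-other m))
                           (subst (λ y → Closes y _) (sym (ψ-other m)) c)

  closes-down : ∀ {x w} → Out (α (σ ⟨$⟩ʳ x)) → Closes (α (σ ⟨$⟩ʳ x)) (α (α (σ ⟨$⟩ʳ x))) →
                Closes (σ ⟨$⟩ʳ x) w → Closes x w
  closes-down {x} (m , c) child rest =
    nest (opening-bud (member⇒bud (trans (cong member eq) m)) (trans (cong faceColour eq) c))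
         (subst₂ Closes (sym eq) (α-involutive _) child)
         rest
    where
    eq : ψ x ≡ α (σ ⟨$⟩ʳ x)
    eq = ψ-tree (trans (sym (member-α _)) m)

  -- The contour of the subtree rooted at the start of e, from any corner of
  -- that vertex, leaves the subtree through e.
  closes-tree : ∀ {e x} → Out e → SameVertex x e → Closes x (α e)
  closes-tree {e} {x} o s = go (⊲-wellFounded e) o s
    where
    go : ∀ {e} → Acc _⊲_ e → ∀ {x} → Out e → SameVertex x e → Closes x (α e)
    go {e} (acc rs) {x} o s = around (proj₁ turns) s (proj₂ turns)
      where
      -- Turns are counted from `σ x`, the first dart that the contour examines. With none left that
      -- dart is `e`, which is neither outside the tree nor a dart towards a child.
      turns : ∃[ i ] iterate (σ ⟨$⟩ʳ_) (σ ⟨$⟩ʳ x) i ≡ e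
      turns = FiniteOrbits.sameOrbit⇒iterate σ-injective (bwd refl ◅ s)
      around : ∀ i {x} → SameVertex x e → iterate (σ ⟨$⟩ʳ_) (σ ⟨$⟩ʳ x) i ≡ e → Closes x (α e)
      around i {x} s eq with corner (σ ⟨$⟩ʳ x)
      -- Whatever the number of turns left, a dart leading up at this vertex is already `e`.
      ... | up o′ = subst (λ d → Closes x (α d)) (out-unique o′ o (bwd refl ◅ s)) (closes-up o′)
      around zero s eq | inside m with () ← trans (sym m) (trans (cong member eq) (proj₁ o))
      around (suc i) s eq | inside m = closes-inside m (around i (bwd refl ◅ s) eq)
      around zero s eq | down (_ , c)
        with () ← trans (sym c) (α-white (trans (cong faceColour eq) (proj₂ o)))
      around (suc i) {x} s eq | down o′ = closes-down o′
        (go (rs (o′ , o , subst (λ d → SameVertex d e) (sym (α-involutive _)) (bwd refl ◅ s))) o′ ε)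
        (around i (bwd refl ◅ s) eq)

  -- By `closes-tree` the two darts of a tree edge lie on the same contour. A rotation step is
  -- either a step of `ψ`, or a step of `ψ` followed by a return across a tree edge. Connectedness
  -- by the tree then yields a single orbit.
  ψ-transitive : ∀ x y → SameOrbit ψ x y
  ψ-transitive x y = EqC.fold orbit
    (λ { (inj₁ s) → EqC.fold orbit (λ { refl → across-σ _ }) s
       ; (inj₂ (m , refl)) → across-tree m })
    (tree-connected x y)
    where
    orbit = EqC.isEquivalence (Steps ψ)
    across-tree : ∀ {d} → member d ≡ true → SameOrbit ψ d (α d)
    across-tree {d} m with faceColour d in c
    ... | black = closes⇒sameOrbit (closes-tree (m , c) ε)
    ... | white = sameOrbit-sym (subst (SameOrbit ψ (α d)) (α-involutive d)
      (closes⇒sameOrbit (closes-tree (trans (member-α d) m , α-black c) ε)))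
    across-σ : ∀ x → SameOrbit ψ x (σ ⟨$⟩ʳ x)
    across-σ x with member (σ ⟨$⟩ʳ x) in m
    ... | false = step (ψ-other m)
    ... | true  = step (ψ-tree m) ◅◅ sameOrbit-sym (across-tree m)

  -- Sending a vertex to its outgoing tree dart matches the vertices of type `t` other than v₀ with
  -- the black buds of type `t`: the dart exists and is unique away from v₀, its edge has the type
  -- of the vertex, and v₀ has no such dart.
  black-buds : ∀ t {m} (vertex : Fin m → Dart) →
               (∀ i → vertexType (vertex i) ≡ t) → (∀ i → ¬ SameVertex (vertex i) v₀) →
               (∀ {i j} → SameVertex (vertex i) (vertex j) → i ≡ j) →
               (∀ v → vertexType v ≡ t → ¬ SameVertex v v₀ → ∃[ i ] SameVertex (vertex i) v) →
               N.Buds black t HasSize m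
  black-buds t vertex type nonroot inj sur = hasSize (N.Buds black t) bud
    (λ {i} {j} eq → inj (at i ◅◅ subst (λ e → SameVertex e (vertex j)) (sym eq) (sameOrbit-sym (at j))))
    (λ { (e , b , c , ty) →
      let o = bud⇒member b , c
          i , s = sur e (trans (sym (edgeType-black c)) ty) (no-out-at-root o)
      in i , out-unique (out i) o (sameOrbit-sym (at i) ◅◅ s) })
    where
    dart : Fin _ → Dart
    dart i = proj₁ (out-exists′ (nonroot i))
    out : ∀ i → Out (dart i)
    out i = proj₁ (proj₂ (out-exists′ (nonroot i)))
    at : ∀ i → SameVertex (vertex i) (dart i)
    at i = proj₂ (proj₂ (out-exists′ (nonroot i)))
    bud : Fin _ → Setoid.Carrier (N.Buds black t)
    bud i = dart i , member⇒bud (proj₁ (out i)) , proj₂ (out i) ,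
      trans (edgeType-black (proj₂ (out i))) (trans (sym (sameVertex⇒vertexType (at i))) (type i))

  black-buds-size : ∀ t → N.Buds black t HasSize p t
  black-buds-size t with t ≟ vertexType v₀
  ... | no t≢ = black-buds t
    (λ i → proj₁ (to i))
    (λ i → proj₂ (to i))
    (λ i s → t≢ (trans (sym (proj₂ (to i))) (sameVertex⇒vertexType s)))
    element-injective
    (λ v ty _ → element-surjective (v , ty))
    where
    S = Orbits (σ ⟨$⟩ʳ_) (λ d → vertexType d ≡ t)
    size-p : S HasSize p t
    size-p = subst (S HasSize_) (count-other t t≢) (vertex-counts t)
    open HasSize S size-p
    open Inverse size-p using (to)
  -- Here v₀ is among the `suc (p t)` vertices of type `t`; punching its index out of the numbering
  -- leaves `p t`.
  ... | yes refl = black-buds t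
    (λ i → proj₁ (to (punchIn root-index i)))
    (λ i → proj₂ (to (punchIn root-index i)))
    (λ i s → punchInᵢ≢i root-index i (element-injective (s ◅◅ sameOrbit-sym at-root)))
    (λ {i} {j} s → punchIn-injective root-index i j (element-injective s))
    (λ v ty v≁v₀ →
      let i , s = element-surjective (v , ty)
          root≢i = λ eq → v≁v₀ (sameOrbit-sym s ◅◅ subst (λ j → SameVertex (proj₁ (to j)) v₀) eq at-root)
      in punchOut root≢i , subst (λ j → SameVertex (proj₁ (to j)) v) (sym (punchIn-punchOut root≢i)) s)
    where
    S = Orbits (σ ⟨$⟩ʳ_) (λ d → vertexType d ≡ t)
    size-p : S HasSize suc (p t)
    size-p = subst (S HasSize_) count-root (vertex-counts t)
    open HasSize S size-p
    open Inverse size-p using (to)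
    root-index : Fin (suc (p t))
    root-index = proj₁ (element-surjective (v₀ , refl))
    at-root : SameVertex (proj₁ (to root-index)) v₀
    at-root = proj₂ (element-surjective (v₀ , refl))

  white-buds-size : ∀ t → N.Buds white t HasSize p t
  white-buds-size t = hasSize (N.Buds white t)
    (λ i → let d , b , c , ty = to i in
       α d , member⇒bud (trans (member-α d) (bud⇒member b)) , α-white c , trans (edgeType-α d) ty)
    (λ eq → element-injective (trans (sym (α-involutive _)) (trans (cong α eq) (α-involutive _))))
    (λ { (d , b , c , ty) →
       let i , eq = element-surjective
             (α d , member⇒bud (trans (member-α d) (bud⇒member b)) , α-black c , trans (edgeType-α d) ty)
       in i , trans (cong α eq) (α-involutive d) })
    where
    open HasSize (N.Buds black t) (black-buds-size t)
    open Inverse (black-buds-size t) using (to)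

  isNebulaOfType : IsNebulaOfType (treeOpening X) p
  isNebulaOfType = record
    { connected     = Rotation.singleFace⇒connected N.system single
    ; single-face   = single
    ; bicoloured    = λ d ¬bud → subst (λ e → faceColour e ≢ faceColour d)
                        (sym (edge-α (not-member ¬bud))) (separates d)
    ; black-degree  = black-degree
    ; black-types   = λ d c → trans (edgeType-black (trans (faceColour-φ d) c))
                        (trans (black-types d c) (cong next (sym (edgeType-black c))))
    ; white-types   = white-types
    ; balanced-buds = λ t → p t , black-buds-size t , white-buds-size t
    } , black-buds-size
    where
    single : ∀ d e → N.SameFace d e
    single = Rotation.transitive⇒singleFace N.system ψ-transitive
    not-member : ∀ {d} → ¬ N.IsBud d → member d ≡ false
    not-member {d} ¬bud with member d
    ... | true  = ⊥-elim (¬bud refl)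
    ... | false = refl
    -- The darts `φ d` and `α d` leave the same vertex. Its type is `next (edgeType (φ d))` seen
    -- from the white dart `φ d`, and `edgeType d` seen from the black dart `α d`.
    white-types : ∀ d → faceColour d ≡ white → next (edgeType (φ d)) ≡ edgeType d
    white-types d c = begin
      next (edgeType (φ d))                               ≡⟨ cong (λ c → sourceType c (edgeType (φ d))) (trans (faceColour-φ d) c) ⟨
      sourceType (faceColour (φ d)) (edgeType (φ d))      ≡⟨ vertexType-source (φ d) ⟨
      vertexType (φ d)                                    ≡⟨ vertexType-σ (φ d) ⟨
      vertexType (σ ⟨$⟩ʳ φ d)                             ≡⟨ cong vertexType (inverseʳ σ) ⟩
      vertexType (α d)                                    ≡⟨ edgeType-white c ⟨
      edgeType d                                          ∎
      where open ≡-Reasoning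

-- Isomorphisms

identity : ∀ {M} → Isomorphism M M
identity = record { bijection = id ; to-σ = λ _ → refl ; to-α = λ _ → refl }

module IsomorphismProperties {M N : RotationSystem} (I : Isomorphism M N) where
  open Isomorphism I
  private
    module M = RotationSystem M
    module N = RotationSystem N

  from : N.Dart → M.Dart
  from = bijection ⟨$⟩ˡ_

  to-injective : ∀ {x y} → to x ≡ to y → x ≡ y
  to-injective = permutation-injective bijection

  to-σ⁻¹ : ∀ d → to (M.σ ⟨$⟩ˡ d) ≡ N.σ ⟨$⟩ˡ (to d)
  to-σ⁻¹ d = Rotation.σ-injective N
    (trans (sym (to-σ _)) (trans (cong to (inverseʳ M.σ)) (sym (inverseʳ N.σ))))

  to-φ : ∀ d → to (M.φ d) ≡ N.φ (to d)
  to-φ d = trans (to-σ⁻¹ (M.α d)) (cong (N.σ ⟨$⟩ˡ_) (to-α d))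

  inverse-isomorphism : Isomorphism N M
  inverse-isomorphism = record
    { bijection = Perm.flip bijection
    ; to-σ = λ d → to-injective (trans (inverseʳ bijection)
        (trans (cong (N.σ ⟨$⟩ʳ_) (sym (inverseʳ bijection))) (sym (to-σ _))))
    ; to-α = λ d → to-injective (trans (inverseʳ bijection)
        (trans (cong N.α (sym (inverseʳ bijection))) (sym (to-α _))))
    }

  pull : {A : Set} {f : M.Dart → A} {g : N.Dart → A} →
         (∀ d → g (to d) ≡ f d) → ∀ d → f (from d) ≡ g d
  pull {g = g} eq d = trans (sym (eq (from d))) (cong g (inverseʳ bijection))

compose : ∀ {L M N} → Isomorphism L M → Isomorphism M N → Isomorphism L N
compose I J = record
  { bijection = I.bijection ∘ₚ J.bijection
  ; to-σ = λ d → trans (cong J.to (I.to-σ d)) (J.to-σ _)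
  ; to-α = λ d → trans (cong J.to (I.to-α d)) (J.to-α _)
  }
  where
  module I = Isomorphism I
  module J = Isomorphism J

≅ᵀ-isEquivalence : ∀ {k} {p : Fin k → ℕ} → IsEquivalence (_≅ᵀ_ {p = p})
≅ᵀ-isEquivalence = record
  { refl  = record
    { isomorphism = identity
    ; to-colour = λ _ → refl ; to-type = λ _ → refl ; to-tree = λ _ → refl ; to-root = ε }
  ; sym   = λ {X} {Y} I →
    let module I = _≅ᵀ_ I
        open IsomorphismProperties I.isomorphism
        module Y⇒X = IsomorphismProperties inverse-isomorphism
    in record
    { isomorphism = inverse-isomorphism
    ; to-colour = pull {f = TreePointed.faceColour X} I.to-colour
    ; to-type = pull {f = TreePointed.vertexType X} I.to-type
    ; to-tree = pull {f = TreePointed.member X} I.to-tree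
    ; to-root = sameOrbit-sym (subst (λ d → TreePointed.SameFace X d (from (TreePointed.root Y)))
        (inverseˡ I.bijection) (sameOrbit-map from Y⇒X.to-φ I.to-root)) }
  ; trans = λ I J →
    let module I = _≅ᵀ_ I
        module J = _≅ᵀ_ J
    in record
    { isomorphism = compose I.isomorphism J.isomorphism
    ; to-colour = λ d → trans (J.to-colour _) (I.to-colour d)
    ; to-type = λ d → trans (J.to-type _) (I.to-type d)
    ; to-tree = λ d → trans (J.to-tree _) (I.to-tree d)
    ; to-root = sameOrbit-map J.to (IsomorphismProperties.to-φ J.isomorphism) I.to-root ◅◅ J.to-root }
  }

≅ᴺ-isEquivalence : ∀ {k} {p : Fin k → ℕ} → IsEquivalence (_≅ᴺ_ {p = p})
≅ᴺ-isEquivalence = record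
  { refl  = record
    { isomorphism = identity
    ; to-colour = λ _ → refl ; to-type = λ _ → refl ; to-root = ε }
  ; sym   = λ {X} {Y} I →
    let module I = _≅ᴺ_ I
        open IsomorphismProperties I.isomorphism
    in record
    { isomorphism = inverse-isomorphism
    ; to-colour = pull {f = RootedBudMap.vertexColour (proj₁ X)} I.to-colour
    ; to-type = pull {f = RootedBudMap.edgeType (proj₁ X)} I.to-type
    ; to-root = sameOrbit-sym (subst
        (λ d → RootedBudMap.SameVertex (proj₁ X) d (from (RootedBudMap.root (proj₁ Y))))
        (inverseˡ I.bijection)
        (sameOrbit-map from (Isomorphism.to-σ inverse-isomorphism) I.to-root)) }
  ; trans = λ I J →
    let module I = _≅ᴺ_ I
        module J = _≅ᴺ_ J
    in record
    { isomorphism = compose I.isomorphism J.isomorphism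
    ; to-colour = λ d → trans (J.to-colour _) (I.to-colour d)
    ; to-type = λ d → trans (J.to-type _) (I.to-type d)
    ; to-root = sameOrbit-map J.to J.to-σ I.to-root ◅◅ J.to-root }
  }

-- The opening respects and reflects isomorphism

module _ {k : ℕ} {p : Fin k → ℕ} {X Y : TreePointed p} where
  private
    module X = TreePointed X
    module Y = TreePointed Y

  treeOpening-cong : ∀ {nX nY} → X ≅ᵀ Y → _≅ᴺ_ {p = p} (treeOpening X , nX) (treeOpening Y , nY)
  treeOpening-cong I = record
    { isomorphism = record { bijection = I.bijection ; to-σ = to-φ ; to-α = to-β }
    ; to-colour   = I.to-colour
    ; to-type     = to-edgeType
    ; to-root     = I.to-root
    }
    where
    module I = _≅ᵀ_ I
    open IsomorphismProperties I.isomorphism using (to-φ)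
    to-β : ∀ d → I.to (if X.member d then d else X.α d)
                 ≡ (if Y.member (I.to d) then I.to d else Y.α (I.to d))
    to-β d rewrite I.to-tree d with X.member d
    ... | true  = refl
    ... | false = I.to-α d
    to-edgeType : ∀ d → Y.edgeType (I.to d) ≡ X.edgeType d
    to-edgeType d with X.faceColour d | Y.faceColour (I.to d) | I.to-colour d
    ... | black | _ | refl = I.to-type d
    ... | white | _ | refl = trans (cong Y.vertexType (sym (I.to-α d))) (I.to-type (X.α d))

  module _ (2≤k : 2 ≤ k) {nX nY} (I : _≅ᴺ_ {p = p} (treeOpening X , nX) (treeOpening Y , nY)) where
    private
      module I = _≅ᴺ_ I
      module OX = Opening 2≤k X
      module OY = Opening 2≤k Y
      module CX = Constellation X.constellation
      module CY = Constellation Y.constellation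
      module BX = BudWord (treeOpening X)
      module BY = BudWord (treeOpening Y)
      module NX = RootedBudMap (treeOpening X)
      module NY = RootedBudMap (treeOpening Y)
    open IsomorphismProperties I.isomorphism

    private
      to-bud : ∀ {d} → NX.IsBud d → NY.IsBud (I.to d)
      to-bud {d} b = trans (sym (I.to-α d)) (cong I.to b)

      from-bud : ∀ {d} → NY.IsBud (I.to d) → NX.IsBud d
      from-bud {d} b = to-injective (trans (I.to-α d) b)

      to-status : ∀ d → BY.status (I.to d) ≡ BX.status d
      to-status d with NX.α d ≟ d
      ... | yes bud = trans (BY.status-bud (to-bud bud)) (cong budStatus (I.to-colour d))
      ... | no edge = BY.status-edge (edge ∘ from-bud)

      to-closes : ∀ {x w} → BX.Closes x w → BY.Closes (I.to x) (I.to w)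
      to-closes = closes-map I.to (λ x → trans (I.to-α _) (cong NY.α (to-σ⁻¹ x))) to-status

      to-member : ∀ d → Y.member (I.to d) ≡ X.member d
      to-member d with X.member d in mX | Y.member (I.to d) in mY
      ... | true  | true  = refl
      ... | false | false = refl
      ... | true  | false = trans (sym mY) (OY.bud⇒member (to-bud (OX.member⇒bud mX)))
      ... | false | true  = trans (sym (OX.bud⇒member (from-bud (OY.member⇒bud mY)))) mX

      to-out : ∀ {d} → OX.Out d → OY.Out (I.to d)
      to-out {d} (m , c) = trans (to-member d) m , trans (I.to-colour d) c

      -- Both matchings of buds are the parenthesis matching.
      to-α-out : ∀ {d} → OX.Out d → I.to (X.α d) ≡ Y.α (I.to d)
      to-α-out o = BY.closes-unique (to-closes (OX.closes-tree o ε)) (OY.closes-tree (to-out o) ε)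

      to-α : ∀ d → I.to (X.α d) ≡ Y.α (I.to d)
      to-α d with OX.corner d
      ... | OX.up o = to-α-out o
      ... | OX.down o = begin
        I.to (X.α d)                      ≡⟨ Y.α-involutive _ ⟨
        Y.α (Y.α (I.to (X.α d)))          ≡⟨ cong Y.α (to-α-out o) ⟨
        Y.α (I.to (X.α (X.α d)))          ≡⟨ cong (Y.α ∘ I.to) (X.α-involutive d) ⟩
        Y.α (I.to d)                      ∎
        where open ≡-Reasoning
      ... | OX.inside m = begin
        I.to (X.α d)                      ≡⟨ cong I.to (OX.edge-α m) ⟨
        I.to (NX.α d)                     ≡⟨ I.to-α d ⟩
        NY.α (I.to d)                     ≡⟨ OY.edge-α (trans (to-member d) m) ⟩
        Y.α (I.to d)                      ∎
        where open ≡-Reasoning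

      to-σ : ∀ d → I.to (X.σ ⟨$⟩ʳ d) ≡ Y.σ ⟨$⟩ʳ I.to d
      to-σ d = begin
        I.to (X.σ ⟨$⟩ʳ d)                               ≡⟨ Y.α-involutive _ ⟨
        Y.α (Y.α (I.to (X.σ ⟨$⟩ʳ d)))                   ≡⟨ cong Y.α (to-α _) ⟨
        -- By the definition of the dual, `NX.σ ⟨$⟩ˡ d` unfolds to `X.α (X.σ ⟨$⟩ʳ d)`, so the
        -- rotation of the constellation is recovered once `α` is.
        Y.α (I.to (NX.σ ⟨$⟩ˡ d))                        ≡⟨ cong Y.α (to-σ⁻¹ d) ⟩
        Y.α (Y.α (Y.σ ⟨$⟩ʳ I.to d))                     ≡⟨ Y.α-involutive _ ⟩
        Y.σ ⟨$⟩ʳ I.to d                                 ∎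
        where open ≡-Reasoning

      to-vertexType : ∀ d → Y.vertexType (I.to d) ≡ X.vertexType d
      to-vertexType d = begin
        Y.vertexType (I.to d)                                            ≡⟨ CY.vertexType-source (I.to d) ⟩
        sourceType (Y.faceColour (I.to d)) (Y.edgeType (I.to d))         ≡⟨ cong₂ sourceType (I.to-colour d) (I.to-type d) ⟩
        sourceType (X.faceColour d) (X.edgeType d)                       ≡⟨ CX.vertexType-source d ⟨
        X.vertexType d                                                   ∎
        where open ≡-Reasoning

    treeOpening-injective : X ≅ᵀ Y
    treeOpening-injective = record
      { isomorphism = record { bijection = I.bijection ; to-σ = to-σ ; to-α = to-α }
      ; to-colour   = I.to-colour
      ; to-type     = to-vertexType
      ; to-tree     = to-member
      ; to-root     = I.to-root
      }

-- Matching parentheses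

mirror-closing : ∀ {c} → mirror c ≡ closing → c ≡ opening
mirror-closing {opening} _ = refl

module _ {n : ℕ} (π : Permutation n n) (transitive : ∀ x y → SameOrbit (π ⟨$⟩ʳ_) x y) where

  transitive-flip : ∀ x y → SameOrbit (Perm.flip π ⟨$⟩ʳ_) x y
  transitive-flip x y = EqC.fold (EqC.isEquivalence _)
    (λ { {x} refl → bwd (inverseˡ π) ◅ ε }) (transitive x y)

  -- The dart before an opening is one lower than the opening and is reached again by going around
  -- the cycle, so an unmatched closing must occur on the way.
  opening-closes : ∀ {s} (h : Fin n → ℕ) →
                   (∀ x → Change (s (π ⟨$⟩ʳ x)) (h x) (h (π ⟨$⟩ʳ x))) →
                   ∀ {o} → s o ≡ opening → ∃[ w ] Word.Closes (π ⟨$⟩ʳ_) s o w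
  opening-closes {s} h change {o} p =
    Height.closes-exists {s = s} h change (permutation-injective π)
      o (π ⟨$⟩ˡ o) (transitive o (π ⟨$⟩ˡ o))
      (≤-reflexive (trans (sym (Height.change-as {s = s} h change (trans (cong s (inverseʳ π)) p)))
                          (cong h (inverseʳ π))))

module Matching {n : ℕ} (π : Permutation n n) (transitive : ∀ x y → SameOrbit (π ⟨$⟩ʳ_) x y)
                (s : Fin n → Status) (h : Fin n → ℕ)
                (change : ∀ x → Change (s (π ⟨$⟩ʳ x)) (h x) (h (π ⟨$⟩ʳ x))) where

  ψ ψ⁻¹ : Fin n → Fin n
  ψ   = π ⟨$⟩ʳ_
  ψ⁻¹ = π ⟨$⟩ˡ_

  open Word ψ s
  open Height {s = s} h change
  private
    module Forth = Reversal {ψ = ψ} {ψ⁻¹ = ψ⁻¹} s (λ x → inverseˡ π {x})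
    module Back = Reversal {ψ = ψ⁻¹} {ψ⁻¹ = ψ} (mirror ∘ s) (λ x → inverseʳ π {x})

  closing-closed : ∀ {w} → s w ≡ closing → ∃[ o ] s o ≡ opening × Closes o w
  closing-closed p =
    -- The match is found by reading backwards. In that direction the height just after reading `x`
    -- is the one just before it in the original direction, hence the shift by `ψ⁻¹`.
    let o , c = opening-closes (Perm.flip π) (transitive-flip π transitive) {s = mirror ∘ s} (h ∘ ψ⁻¹)
                  (λ x → change-mirror (s (ψ⁻¹ x)) (subst
                    (λ y → Change (s y) (h (ψ⁻¹ (ψ⁻¹ x))) (h y)) (inverseʳ π) (change (ψ⁻¹ (ψ⁻¹ x)))))
                  (cong mirror p)
    in o , mirror-closing (Word.closes⇒closing ψ⁻¹ (mirror ∘ s) c) ,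
       closes-map (λ x → x) (λ _ → refl) (λ x → sym (mirror-involutive (s x)))
         (Back.closes-reverse (cong mirror p) c)

  closes-unique-opening : ∀ {o o′ w} → s o ≡ opening → s o′ ≡ opening →
                          Closes o w → Closes o′ w → o ≡ o′
  closes-unique-opening p p′ c c′ = Word.closes-unique ψ⁻¹ (mirror ∘ s)
    (Forth.closes-reverse p c) (Forth.closes-reverse p′ c′)

  data Role (d : Fin n) : Set where
    plain   : s d ≡ plain → Role d
    opening : ∀ {w} → s d ≡ opening → Closes d w → Role d
    closing : ∀ {o} → s d ≡ closing → s o ≡ opening → Closes o d → Role d

  abstract
    role : ∀ d → Role d
    role d with s d in eq
    ... | plain   = plain eq
    ... | opening = opening eq (proj₂ (opening-closes π transitive h change eq))
    ... | closing = let _ , p , c = closing-closed eq in closing eq p c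

  partner : ∀ {d} → Role d → Fin n
  partner {d} (plain _)       = d
  partner (opening {w} _ _)   = w
  partner (closing {o} _ _ _) = o

  -- Makes `τ` computable from any evidence at hand, independently of the evidence chosen by `role`.
  partner-unique : ∀ {d} (u v : Role d) → partner u ≡ partner v
  partner-unique (plain _)       (plain _)         = refl
  partner-unique (plain p)       (opening q _)     = clash p q λ ()
  partner-unique (plain p)       (closing q _ _)   = clash p q λ ()
  partner-unique (opening p _)   (plain q)         = clash p q λ ()
  partner-unique (opening _ c)   (opening _ c′)    = closes-unique c c′
  partner-unique (opening p _)   (closing q _ _)   = clash p q λ ()
  partner-unique (closing p _ _) (plain q)         = clash p q λ ()
  partner-unique (closing p _ _) (opening q _)     = clash p q λ ()
  partner-unique (closing _ p c) (closing _ p′ c′) = closes-unique-opening p p′ c c′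

  τ : Fin n → Fin n
  τ d = partner (role d)

  τ-plain : ∀ {d} → s d ≡ plain → τ d ≡ d
  τ-plain {d} p = partner-unique (role d) (plain p)

  τ-opening : ∀ {o w} → s o ≡ opening → Closes o w → τ o ≡ w
  τ-opening {o} p c = partner-unique (role o) (opening p c)

  τ-closing : ∀ {o w} → s o ≡ opening → Closes o w → τ w ≡ o
  τ-closing {w = w} p c = partner-unique (role w) (closing (closes⇒closing c) p c)

  τ-involutive : ∀ d → τ (τ d) ≡ d
  τ-involutive d with role d
  ... | plain p       = τ-plain p
  ... | opening p c   = τ-closing p c
  ... | closing _ p c = τ-opening p c

  glue : Fin n → Fin n
  glue x = τ (ψ x)

  glue-injective : ∀ {x y} → glue x ≡ glue y → x ≡ y
  glue-injective eq = permutation-injective π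
    (trans (sym (τ-involutive _)) (trans (cong τ eq) (τ-involutive _)))

  -- All corners of a glued vertex have the same first unmatched closing, the bud by which the
  -- contour leaves towards the parent. If that closing comes next, `glue` moves to the opening
  -- matched with it, which it closes by definition; otherwise `glue` makes the first step of the
  -- derivation.
  closes-glue : ∀ {x w} → Closes x w → Closes (glue x) w
  closes-glue (close p)    =
    let _ , q , c = closing-closed p in subst (λ o → Closes o _) (sym (τ-closing q c)) c
  closes-glue (skip p c)   = subst (λ y → Closes y _) (sym (τ-plain p)) c
  closes-glue (nest p c d) = subst (λ y → Closes y _) (sym (τ-opening p c)) d

  closes-sameOrbit : ∀ {x y w} → SameOrbit glue x y → Closes x w → Closes y w
  closes-sameOrbit {x} {y} {w} s c =
    let i , eq = FiniteOrbits.sameOrbit⇒iterate glue-injective s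
    in subst (λ z → Closes z w) eq (around i c)
    where
    around : ∀ i {x} → Closes x w → Closes (iterate glue x i) w
    around zero    c = c
    around (suc i) c = around i (closes-glue c)

  -- Each constructor on the spine of the derivation is one step of `glue`, since `glue` jumps from
  -- a corner directly over a matched pair. The last step moves from the closing `w` to its match.
  closes⇒sameOrbit-glue : ∀ {x w} → Closes x w → SameOrbit glue x (τ w)
  closes⇒sameOrbit-glue (close p)    = step refl
  closes⇒sameOrbit-glue (skip p c)   = fwd (τ-plain p) ◅ closes⇒sameOrbit-glue c
  closes⇒sameOrbit-glue (nest p c d) = fwd (τ-opening p c) ◅ closes⇒sameOrbit-glue d

  balanced⇒sameOrbit-glue : ∀ {x y} → Balanced x y → SameOrbit glue x y
  balanced⇒sameOrbit-glue stop         = ε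
  balanced⇒sameOrbit-glue (skip p b)   = fwd (τ-plain p) ◅ balanced⇒sameOrbit-glue b
  balanced⇒sameOrbit-glue (jump p c b) = fwd (τ-opening p c) ◅ balanced⇒sameOrbit-glue b

  height-glue : ∀ x → h (glue x) ≡ h x
  height-glue x with role (ψ x)
  ... | plain p       = sym (change-as p)
  ... | opening p c   = suc-injective (trans (sym (closes-height c)) (change-as p))
  ... | closing p _ c = trans (closes-height c) (sym (change-as p))

  -- On the way from `x` down to a lowest dart, either an unmatched closing occurs, or the stretch
  -- is balanced and `glue` follows it without leaving the vertex.
  root-or-closes : ∀ {v₀} → (∀ x → h v₀ ≤ h x) →
                   ∀ x → (∃[ w ] Closes x w) ⊎ SameOrbit glue x v₀
  root-or-closes {v₀} lowest x
    with closes-or-balanced (permutation-injective π)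
           x v₀ (transitive x v₀) (lowest x)
  ... | inj₁ c = inj₁ c
  ... | inj₂ b = inj₂ (balanced⇒sameOrbit-glue b)

lowest : ∀ {n} (h : Fin n → ℕ) → Fin n → ∃[ x ] (∀ y → h x ≤ h y)
lowest h x =
  let m , (y , eq) , min = least (λ m → any? (λ y → h y ℕ-≟ m)) (x , refl)
  in y , λ z → ≤-trans (≤-reflexive eq) (≮⇒≥ λ lt → min lt (z , refl))

bounded : ∀ {n} (h : Fin n → ℕ) → ∃[ b ] (∀ x → h x ≤ b)
bounded {zero}  h = 0 , λ ()
bounded {suc n} h =
  let b , le = bounded (h ∘ suc)
  in h zero + b , λ { zero → m≤m+n (h zero) b ; (suc x) → ≤-trans (le x) (m≤n+m b (h zero)) }

-- Gluing the buds of a nebula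

module BudBalance {k : ℕ} (N : RootedBudMap k) (nebula : IsNebula N) where
  open RootedBudMap N
  open BudWord N using (status; status-bud; status-edge)
  open IsNebula nebula

  numbered : ∀ c t → Buds c t HasSize proj₁ (balanced-buds t)
  numbered black t = proj₁ (proj₂ (balanced-buds t))
  numbered white t = proj₂ (proj₂ (balanced-buds t))

  Bud : Colour → Fin k → Set
  Bud c t = Setoid.Carrier (Buds c t)

  swap : ∀ c t → Bud c t → Bud (other c) t
  swap c t x = Inverse.to (numbered (other c) t) (Inverse.from (numbered c t) x)

  data Kind (d : Dart) : Set where
    edge : ¬ IsBud d → Kind d
    bud  : ∀ {c t} → IsBud d × vertexColour d ≡ c × edgeType d ≡ t → Kind d

  kind : ∀ d → Kind d
  kind d with α d ≟ d
  ... | yes b = bud (b , refl , refl)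
  ... | no ¬b = edge ¬b

  twin : ∀ {d} → Kind d → Dart
  twin {d} (edge _)        = d
  twin {d} (bud {c} {t} x) = proj₁ (swap c t (d , x))

  -- Elements of `Buds` are compared by their darts, so the numbering does not see the evidence that
  -- comes with a bud.
  twin-unique : ∀ {d} (u v : Kind d) → twin u ≡ twin v
  twin-unique (edge _)  (edge _)       = refl
  twin-unique (edge ¬b) (bud (b , _))  = ⊥-elim (¬b b)
  twin-unique (bud (b , _)) (edge ¬b)  = ⊥-elim (¬b b)
  twin-unique {d} (bud {c} {t} x@(_ , refl , refl)) (bud y@(_ , refl , refl)) =
    cong (λ i → proj₁ (Inverse.to (numbered (other c) t) i))
      (Inverse.from-cong (numbered c t) {d , x} {d , y} refl)

  twin-kind : ∀ {d} (u : Kind d) → Kind (twin u)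
  twin-kind (edge ¬b)           = edge ¬b
  twin-kind {d} (bud {c} {t} x) = bud (proj₂ (swap c t (d , x)))

  twin-twin : ∀ {d} (u : Kind d) → twin (twin-kind u) ≡ d
  twin-twin (edge _) = refl
  twin-twin {d} (bud {black} {t} x) = trans
    (cong (proj₁ ∘ Inverse.to (numbered black t)) (Inverse.inverseʳ (numbered white t) refl))
    (Inverse.inverseˡ (numbered black t) {y = Inverse.from (numbered black t) (d , x)} refl)
  twin-twin {d} (bud {white} {t} x) = trans
    (cong (proj₁ ∘ Inverse.to (numbered white t)) (Inverse.inverseʳ (numbered black t) refl))
    (Inverse.inverseˡ (numbered white t) {y = Inverse.from (numbered white t) (d , x)} refl)

  -- Pairs the black and white buds of each type that bear the same number. This is an auxiliary
  -- pairing for counting, in general different from the parenthesis matching: it turns the sum of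
  -- openings into the sum of closings.
  θ : Dart → Dart
  θ d = twin (kind d)

  θ-involutive : ∀ d → θ (θ d) ≡ d
  θ-involutive d = trans (twin-unique (kind (θ d)) (twin-kind (kind d))) (twin-twin (kind d))

  status-bud-of : ∀ {c t} (x : Bud c t) → status (proj₁ x) ≡ budStatus c
  status-bud-of (_ , b , c , _) = trans (status-bud b) (cong budStatus c)

  indicator-θ : ∀ d → indicator opening (status d) ≡ indicator closing (status (θ d))
  indicator-θ d = go (kind d)
    where
    go : (u : Kind d) → indicator opening (status d) ≡ indicator closing (status (twin u))
    go (edge ¬b) rewrite status-edge ¬b = refl
    go (bud {black} {t} x)
      rewrite status-bud-of {black} {t} (d , x) | status-bud-of (swap black t (d , x)) = refl
    go (bud {white} {t} x)
      rewrite status-bud-of {white} {t} (d , x) | status-bud-of (swap white t (d , x)) = refl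

  balanced : sum {size} (indicator opening ∘ status) ≡ sum {size} (indicator closing ∘ status)
  balanced = trans (sum-cong-≗ {size} indicator-θ)
    (sym (sum-permute (indicator closing ∘ status) (permutation θ θ θ-involutive θ-involutive)))

-- The tree-pointed constellation recovered from a nebula

module Gluing {k : ℕ} (2≤k : 2 ≤ k) {p : Fin k → ℕ} (nebula : Nebula p) where

  N : RootedBudMap k
  N = proj₁ nebula

  open RootedBudMap N using
    (Dart; size; σ; vertexColour; vertexColour-σ; edgeType; edgeType-α; root; root-black; IsBud)
  private
    module N = RootedBudMap N
  open BudWord N using
    (turn; ψ; status; opening-bud; opening⇒; closing⇒; plain⇒; status-edge)
  open Word ψ status
  open IsNebula (proj₁ (proj₂ nebula))

  transitive : ∀ x y → SameOrbit ψ x y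
  transitive = Rotation.singleFace⇒transitive N.system single-face

  abstract
    height : Dart → ℕ
    height = ConstructHeight.height turn status transitive root
      (BudBalance.balanced N (proj₁ (proj₂ nebula)))

    change : ∀ x → Change (status (ψ x)) (height x) (height (ψ x))
    change = ConstructHeight.change turn status transitive root
      (BudBalance.balanced N (proj₁ (proj₂ nebula)))

  open Matching turn transitive status height change
    using (τ; τ-plain; τ-opening; τ-closing; glue; Role; plain; opening; closing; role;
           closes-sameOrbit; closes⇒sameOrbit-glue; height-glue; root-or-closes)
  open Height {s = status} height change using (closes-height)

  -- `N.α` fixes the buds and `τ` fixes the rest, so the composite is the old involution on edges
  -- and the parenthesis matching on buds.
  α′ : Dart → Dart
  α′ d = τ (N.α d)

  α′-edge : ∀ {d} → ¬ IsBud d → α′ d ≡ N.α d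
  α′-edge {d} ¬b = τ-plain (status-edge λ b → ¬b (trans (sym b) (N.α-involutive d)))

  α′-bud : ∀ {d} → IsBud d → α′ d ≡ τ d
  α′-bud b = cong τ b

  source : Dart → Fin k
  source d = sourceType (vertexColour d) (edgeType d)

  -- The other dart of the edge at `σ ⟨$⟩ˡ x` should leave the same vertex as `x`. The opposite
  -- directions of the type rules at black and white vertices say exactly that.
  source-turn : ∀ x → sourceType (other (vertexColour x)) (edgeType (σ ⟨$⟩ˡ x)) ≡ source x
  source-turn x with vertexColour x in c
  ... | black = trans (sym (black-types _ (trans (sym (vertexColour-σ _)) (trans (cong vertexColour (inverseʳ σ)) c))))
                      (cong edgeType (inverseʳ σ))
  ... | white = trans (sym (white-types _ (trans (sym (vertexColour-σ _)) (trans (cong vertexColour (inverseʳ σ)) c))))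
                      (cong (next ∘ edgeType) (inverseʳ σ))

  colour-σ⁻¹ : ∀ x → vertexColour (σ ⟨$⟩ˡ x) ≡ vertexColour x
  colour-σ⁻¹ x = trans (sym (vertexColour-σ _)) (cong vertexColour (inverseʳ σ))

  α-bud : ∀ {d} → IsBud (N.α d) → IsBud d
  α-bud {d} b = trans (sym b) (N.α-involutive d)

  source-plain : ∀ {x} → status (ψ x) ≡ plain → source (ψ x) ≡ source x
  source-plain {x} s = trans
    (cong₂ sourceType
      (trans (≢⇒other (bicoloured _ λ b → plain⇒ s (cong N.α b))) (cong other (colour-σ⁻¹ x)))
      (edgeType-α _))
    (source-turn x)

  private
    turned : ∀ {x} → IsBud (ψ x) → ψ x ≡ σ ⟨$⟩ˡ x
    turned b = α-bud b

    turned-colour : ∀ {x} → IsBud (ψ x) → vertexColour (ψ x) ≡ vertexColour x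
    turned-colour b = trans (cong vertexColour (turned b)) (colour-σ⁻¹ _)

  source-opening : ∀ {x} → status (ψ x) ≡ opening → next (source (ψ x)) ≡ source x
  source-opening {x} s = begin
    next (sourceType (vertexColour (ψ x)) (edgeType (ψ x)))      ≡⟨ cong₂ (λ c t → next (sourceType c t)) c (edgeType-α _) ⟩
    next (edgeType (σ ⟨$⟩ˡ x))                                   ≡⟨ cong (λ c → sourceType (other c) (edgeType (σ ⟨$⟩ˡ x))) (trans (sym (turned-colour b)) c) ⟨
    sourceType (other (vertexColour x)) (edgeType (σ ⟨$⟩ˡ x))    ≡⟨ source-turn x ⟩
    source x                                                     ∎
    where
    open ≡-Reasoning
    b = proj₁ (opening⇒ s)
    c = proj₂ (opening⇒ s)

  source-closing : ∀ {x} → status (ψ x) ≡ closing → source (ψ x) ≡ next (source x)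
  source-closing {x} s = begin
    sourceType (vertexColour (ψ x)) (edgeType (ψ x))                   ≡⟨ cong₂ sourceType c (edgeType-α _) ⟩
    next (edgeType (σ ⟨$⟩ˡ x))                                         ≡⟨ cong (λ c → next (sourceType (other c) (edgeType (σ ⟨$⟩ˡ x)))) (trans (sym (turned-colour b)) c) ⟨
    next (sourceType (other (vertexColour x)) (edgeType (σ ⟨$⟩ˡ x)))   ≡⟨ cong next (source-turn x) ⟩
    next (source x)                                                    ∎
    where
    open ≡-Reasoning
    b = proj₁ (closing⇒ s)
    c = proj₂ (closing⇒ s)

  -- The counterpart modulo k of `closes-height`, with the opposite sign: the path to `w` goes down
  -- one level, so the type goes up by one.
  closes-source : ∀ {x w} → Closes x w → source w ≡ next (source x)
  closes-source (close s)    = source-closing s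
  closes-source (skip s c)   = trans (closes-source c) (cong next (source-plain s))
  closes-source (nest s c d) =
    trans (closes-source d) (cong next (trans (closes-source c) (source-opening s)))

  source-glue : ∀ x → source (glue x) ≡ source x
  source-glue x with role (ψ x)
  ... | plain s       = source-plain s
  ... | opening s c   = trans (closes-source c) (source-opening s)
  ... | closing s _ c = next-injective (trans (sym (closes-source c)) (source-closing s))

  matched-edgeType : ∀ {o w} → status o ≡ opening → Closes o w → edgeType w ≡ edgeType o
  matched-edgeType {o} {w} s c = next-injective (begin
    next (edgeType w)      ≡⟨ cong (λ c → sourceType c (edgeType w)) (proj₂ (closing⇒ (closes⇒closing c))) ⟨
    source w               ≡⟨ closes-source c ⟩
    next (source o)        ≡⟨ cong (λ c → next (sourceType c (edgeType o))) (proj₂ (opening⇒ s)) ⟩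
    next (edgeType o)      ∎)
    where open ≡-Reasoning

  data Pair (d : Dart) : Set where
    edge : ¬ IsBud d → α′ d ≡ N.α d → Pair d
    up   : ∀ {w} → status d ≡ opening → Closes d w → α′ d ≡ w → Pair d
    down : ∀ {o} → status o ≡ opening → Closes o d → α′ d ≡ o → Pair d

  pair : ∀ d → Pair d
  pair d with role d
  ... | plain s       = edge (plain⇒ s) (α′-edge (plain⇒ s))
  ... | opening s c   = up s c (trans (α′-bud (proj₁ (opening⇒ s))) (τ-opening s c))
  ... | closing t s c = down s c (trans (α′-bud (proj₁ (closing⇒ t))) (τ-closing s c))

  α′-involutive : ∀ d → α′ (α′ d) ≡ d
  α′-involutive d with pair d
  ... | edge ¬b eq = trans (cong α′ eq) (trans (cong τ (N.α-involutive d)) (τ-plain (status-edge ¬b)))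
  ... | up s c eq =
    trans (cong α′ eq) (trans (α′-bud (proj₁ (closing⇒ (closes⇒closing c)))) (τ-closing s c))
  ... | down s c eq = trans (cong α′ eq) (trans (α′-bud (proj₁ (opening⇒ s))) (τ-opening s c))

  separates′ : ∀ d → vertexColour (α′ d) ≢ vertexColour d
  separates′ d same with pair d
  ... | edge ¬b eq = bicoloured d ¬b (trans (cong vertexColour (sym eq)) same)
  ... | up s c eq with () ← trans (sym (proj₂ (opening⇒ s)))
    (trans (sym same) (trans (cong vertexColour eq) (proj₂ (closing⇒ (closes⇒closing c)))))
  ... | down s c eq with () ← trans (sym (proj₂ (opening⇒ s)))
    (trans (sym (cong vertexColour eq)) (trans same (proj₂ (closing⇒ (closes⇒closing c)))))

  edgeType-α′ : ∀ d → edgeType (α′ d) ≡ edgeType d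
  edgeType-α′ d with pair d
  ... | edge ¬b eq  = trans (cong edgeType eq) (edgeType-α d)
  ... | up s c eq   = trans (cong edgeType eq) (matched-edgeType s c)
  ... | down s c eq = trans (cong edgeType eq) (sym (matched-edgeType s c))

  glued : RotationSystem
  glued = record
    { size         = size
    ; σ            = permutation glue (λ d → σ ⟨$⟩ʳ α′ d)
                       (λ d → trans (cong α′ (inverseˡ σ)) (α′-involutive d))
                       (λ d → trans (cong (σ ⟨$⟩ʳ_) (α′-involutive _)) (inverseʳ σ))
    ; α            = α′
    ; α-involutive = α′-involutive
    }

  private
    module G = RotationSystem glued

  -- `glue` is `α′` after the inverse of `σ`, chosen so that the faces of the glued map are the
  -- vertices of the nebula.
  φ-glued : ∀ d → G.φ d ≡ σ ⟨$⟩ʳ d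
  φ-glued d = cong (σ ⟨$⟩ʳ_) (α′-involutive d)

  tree : EdgeSet glued
  tree = record { member = member ; member-α = member-α }
    where
    member : Dart → Bool
    member d = does (N.α d ≟ d)
    both : ∀ {d e} → IsBud d → IsBud e → member d ≡ member e
    both {d} {e} b b′ = trans (dec-true (N.α d ≟ d) b) (sym (dec-true (N.α e ≟ e) b′))
    member-α : ∀ d → member (α′ d) ≡ member d
    member-α d with pair d
    ... | edge ¬b eq  = trans (dec-false (N.α (α′ d) ≟ α′ d)
      λ b → ¬b (α-bud (subst IsBud eq b))) (sym (dec-false (N.α d ≟ d) ¬b))
    ... | up s c eq   = both (subst IsBud (sym eq) (proj₁ (closing⇒ (closes⇒closing c)))) (proj₁ (opening⇒ s))
    ... | down s c eq = both (subst IsBud (sym eq) (proj₁ (opening⇒ s))) (proj₁ (closing⇒ (closes⇒closing c)))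

  open EdgeSet tree using (member)

  bud⇒member : ∀ {d} → IsBud d → member d ≡ true
  bud⇒member {d} = dec-true (N.α d ≟ d)

  member⇒bud : ∀ {d} → member d ≡ true → IsBud d
  member⇒bud {d} m with N.α d ≟ d
  ... | yes b = b

  tree-connected : G.ConnectedBy (InSet tree)
  tree-connected d e = EqC.fold (EqC.isEquivalence _) (λ { {x} refl → across x }) (transitive d e)
    where
    across : ∀ x → EqC.EqClosure (λ x y → G.SameVertex x y ⊎ (InSet tree x × α′ x ≡ y)) x (ψ x)
    across x with N.α (ψ x) ≟ ψ x
    ... | yes b = fwd (inj₁ (step refl)) ◅ bwd (inj₂ (bud⇒member b , α′-bud b)) ◅ ε
    ... | no ¬b = fwd (inj₁ (step (τ-plain (status-edge ¬b)))) ◅ ε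

  constellation : RootedConstellation k
  constellation = record
    { system       = glued
    ; no-buds      = λ d b → separates′ d (cong vertexColour b)
    ; connected    = λ d e → EqC.map (λ { (inj₁ s) → inj₁ s ; (inj₂ (_ , eq)) → inj₂ (tt , eq) })
                       (tree-connected d e)
    ; faceColour   = vertexColour
    ; faceColour-φ = λ d → trans (cong vertexColour (φ-glued d)) (vertexColour-σ d)
    ; vertexType   = source
    ; vertexType-σ = source-glue
    ; separates    = separates′
    ; black-degree = black-degree′
    ; black-types  = black-types′
    ; root         = root
    ; root-black   = root-black
    }
    where
    black-degree′ : ∀ d → vertexColour d ≡ black → Elements (G.SameFace d) HasSize k
    black-degree′ d c = hasSize (Elements (G.SameFace d))
      (λ i → let e , s = to i in e , sameOrbit-map (λ x → x) (λ x → sym (φ-glued x)) s)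
      element-injective
      (λ { (e , s) → element-surjective (e , sameOrbit-map (λ x → x) φ-glued s) })
      where
      open HasSize (Elements (N.SameVertex d)) (black-degree d c)
      open Inverse (black-degree d c) using (to)
    black-types′ : ∀ d → vertexColour d ≡ black → source (G.φ d) ≡ next (source d)
    black-types′ d c = begin
      source (G.φ d)               ≡⟨ cong source (φ-glued d) ⟩
      source (σ ⟨$⟩ʳ d)            ≡⟨ cong (λ c → sourceType c (edgeType (σ ⟨$⟩ʳ d))) (trans (vertexColour-σ d) c) ⟩
      edgeType (σ ⟨$⟩ʳ d)          ≡⟨ black-types d c ⟩
      next (edgeType d)            ≡⟨ cong (λ c → next (sourceType c (edgeType d))) c ⟨
      next (source d)              ∎
      where open ≡-Reasoning

  private
    module C = RootedConstellation constellation
    module K = Constellation constellation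

  edgeType-glued : ∀ d → C.edgeType d ≡ edgeType d
  edgeType-glued d = go (vertexColour d) refl
    where
    go : ∀ c → vertexColour d ≡ c → C.edgeType d ≡ edgeType d
    go black c = trans (K.edgeType-black c) (cong (λ c → sourceType c (edgeType d)) c)
    go white c = trans (K.edgeType-white c) (trans
      (cong (λ c → sourceType c (edgeType (α′ d))) (K.α-black c)) (edgeType-α′ d))

  Up : Dart → Set
  Up d = member d ≡ true × vertexColour d ≡ black

  up-opening : ∀ {d} → Up d → status d ≡ opening
  up-opening (m , c) = opening-bud (member⇒bud m) c

  up-α′ : ∀ {d} → member d ≡ true → vertexColour d ≡ white → Up (α′ d)
  up-α′ {d} m c = trans (EdgeSet.member-α tree d) m , K.α-black c

  up-closes : ∀ {d} → Up d → Closes d (α′ d)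
  up-closes {d} u@(m , _) with pair d
  ... | edge ¬b _ = ⊥-elim (¬b (member⇒bud m))
  ... | up _ c eq = subst (Closes d) (sym eq) c
  ... | down s c _ = clash (up-opening u) (closes⇒closing c) λ ()

  up-unique : ∀ {d e w} → Up d → Closes d w → Up e → Closes e w → d ≡ e
  up-unique u c v c′ = trans (sym (τ-closing (up-opening u) c)) (τ-closing (up-opening v) c′)

  -- `τ w` is the black bud at which the contour enters this vertex from its parent, and so the
  -- start of the edge towards v₀.
  up-exists : ∀ {v w} → Closes v w → Up (τ w) × Closes (τ w) w × G.SameVertex v (τ w)
  up-exists {v} {w} c = go (role w)
    where
    go : Role w → Up (τ w) × Closes (τ w) w × G.SameVertex v (τ w)
    go (plain s)     = clash (closes⇒closing c) s λ ()
    go (opening s _) = clash (closes⇒closing c) s λ ()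
    go (closing _ s d) rewrite τ-closing s d =
      (bud⇒member (proj₁ (opening⇒ s)) , proj₂ (opening⇒ s)) , d ,
      subst (G.SameVertex v) (τ-closing s d) (closes⇒sameOrbit-glue c)

  height-vertex : ∀ {x y} → G.SameVertex x y → height x ≡ height y
  height-vertex = sameOrbit-constant height height-glue

  abstract
    v₀ : Dart
    v₀ = proj₁ (lowest height root)

    v₀-lowest : ∀ x → height v₀ ≤ height x
    v₀-lowest = proj₂ (lowest height root)

  -- The closing `w` would lie one level below the lowest dart.
  v₀-unclosed : ∀ {v w} → G.SameVertex v v₀ → ¬ Closes v w
  v₀-unclosed {w = w} s c = <-irrefl refl (<-≤-trans
    (≤-reflexive (sym (closes-height (closes-sameOrbit s c)))) (v₀-lowest w))

  acyclic : ¬ Cycle tree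
  acyclic cycle = climb-down zero (<-wellFounded _)
    where
    open Cycle cycle
    bound = proj₁ (bounded height)
    -- The white dart leads into a vertex whose unique black tree dart is `α′ (dart i)`. Leaving by
    -- it would reuse the same edge, so `distinct-edges` collapses the two positions.
    returns : ∀ i → vertexColour (dart i) ≡ white → vertexColour (dart (next i)) ≡ black → i ≡ next i
    returns i c c′ =
      let u = up-α′ (in-set i) c
      in distinct-edges i (next i) (step (up-unique u (up-closes u) (in-set (next i) , c′)
           (closes-sameOrbit (consecutive i) (up-closes u))))
    -- A dart of the tree entering a vertex from its parent cannot be followed
    -- by one going back up, so the cycle would descend forever.
    descend : ∀ i → Acc _<_ (bound ∸ height (dart i)) → vertexColour (dart i) ≢ white
    descend i (acc rs) c with vertexColour (dart (next i)) in c′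
    ... | black with () ← trans (sym c) (trans (cong (vertexColour ∘ dart) (returns i c c′)) c′)
    ... | white = descend (next i)
      (rs (∸-monoʳ-< (≤-reflexive (sym higher)) (proj₂ (bounded height) (dart (next i))))) c′
      where
      higher : height (dart (next i)) ≡ suc (height (dart i))
      higher = trans (sym (height-vertex (consecutive i)))
        (trans (closes-height (up-closes (up-α′ (in-set i) c)))
               (cong (suc ∘ height) (α′-involutive (dart i))))
    -- A black dart leads to a lower vertex, so following the cycle must eventually meet a white
    -- dart, where `descend` takes over.
    climb-down : ∀ i → ¬ Acc _<_ (height (dart i))
    climb-down i (acc rs) with vertexColour (dart i) in c
    ... | white = descend i (<-wellFounded _) c
    ... | black = climb-down (next i) (rs (≤-reflexive (trans
      (cong suc (sym (height-vertex (consecutive i))))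
      (sym (closes-height (up-closes (in-set i , c)))))))

  isArborescence : C.IsArborescence v₀ tree
  isArborescence = record
    { spanning-tree = record { connected = tree-connected ; acyclic = acyclic }
    ; unique-edge   = unique-edge
    }
    where
    unique-edge : ∀ v → ¬ G.SameVertex v v₀ →
      ∃! G.SameEdge (λ e → InSet tree e × C.edgeType e ≡ source v × C.IncidentTo v e)
    unique-edge v v≁v₀ with root-or-closes v₀-lowest v
    ... | inj₂ s = ⊥-elim (v≁v₀ s)
    ... | inj₁ (w , c) =
      let u , d , s = up-exists c in
      τ w , (proj₁ u , trans (K.edgeType-black (proj₂ u)) (sym (K.sameVertex⇒vertexType s)) , inj₁ s) ,
      λ { {e} (m , t , inc) → unique e m t inc (vertexColour e) refl }
      where
      matched : ∀ {e} → Up e → G.SameVertex v e → τ w ≡ e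
      matched u s = let u′ , d , _ = up-exists c in up-unique u′ d u (closes-sameOrbit s c)
      unique : ∀ e → InSet tree e → C.edgeType e ≡ source v → C.IncidentTo v e →
               ∀ c → vertexColour e ≡ c → G.SameEdge (τ w) e
      unique e m t (inj₁ s) black ce = subst (G.SameEdge (τ w)) (matched (m , ce) s) ε
      unique e m t (inj₂ s) black ce = ⊥-elim (next-≢ 2≤k (source v)
        (trans (cong next (trans (sym t) (K.edgeType-black ce)))
               (trans (sym (K.vertexType-head ce)) (sym (K.sameVertex⇒vertexType s)))))
      unique e m t (inj₂ s) white ce =
        subst (λ d → G.SameEdge d e) (sym (matched (up-α′ m ce) s)) (bwd refl ◅ ε)
      unique e m t (inj₁ s) white ce = ⊥-elim (next-≢ 2≤k (source v)
        (trans (cong next (trans (sym t) (K.edgeType-white ce)))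
          (trans (sym (K.vertexType-head (K.α-black ce)))
            (trans (cong source (α′-involutive e)) (sym (K.sameVertex⇒vertexType s))))))

  vertexCount : Fin k → ℕ
  vertexCount t = if does (t ≟ source v₀) then suc (p t) else p t

  module NonRoot (t : Fin k) where
    private
      S = N.Buds black t
    open HasSize S (proj₂ (proj₂ nebula) t)
    open Inverse (proj₂ (proj₂ nebula) t) using (to)

    vertex : Fin (p t) → Setoid.Carrier (Orbits glue (λ d → source d ≡ t))
    vertex i = let e , _ , c , ty = to i in
      e , trans (cong (λ c → sourceType c (edgeType e)) c) ty

    vertex-up : ∀ i → Up (proj₁ (vertex i))
    vertex-up i = let _ , b , c , _ = to i in bud⇒member b , c

    vertex-nonroot : ∀ i → ¬ G.SameVertex (proj₁ (vertex i)) v₀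
    vertex-nonroot i s = v₀-unclosed s (up-closes (vertex-up i))

    vertex-injective : ∀ {i j} → G.SameVertex (proj₁ (vertex i)) (proj₁ (vertex j)) → i ≡ j
    vertex-injective {i} {j} s = element-injective
      (up-unique (vertex-up i) (up-closes (vertex-up i)) (vertex-up j)
        (closes-sameOrbit s (up-closes (vertex-up i))))

    vertex-surjective : ∀ v → source v ≡ t →
      (∃[ i ] G.SameVertex (proj₁ (vertex i)) v) ⊎ G.SameVertex v v₀
    vertex-surjective v ty with root-or-closes v₀-lowest v
    ... | inj₂ s = inj₂ s
    ... | inj₁ (w , c) =
      let (m , b) , _ , s = up-exists c
          i , eq = element-surjective (τ w , member⇒bud m , b ,
            trans (cong (λ c → sourceType c (edgeType (τ w))) (sym b))
                  (trans (sym (K.sameVertex⇒vertexType s)) ty))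
      in inj₁ (i , subst (λ d → G.SameVertex d v) (sym eq) (sameOrbit-sym s))

  -- Vertices other than v₀ are numbered by their black buds. The vertex of v₀ has none and supplies
  -- the one additional vertex of its type.
  hasVertexCounts : C.HasVertexCounts vertexCount
  hasVertexCounts t with t ≟ source v₀
  ... | no t≢ = hasSize (Orbits glue (λ d → source d ≡ t)) vertex vertex-injective
    λ { (v , ty) → surjective v ty (vertex-surjective v ty) }
    where
    open NonRoot t
    surjective : ∀ v → source v ≡ t → (∃[ i ] G.SameVertex (proj₁ (vertex i)) v) ⊎ G.SameVertex v v₀ →
                 ∃[ i ] G.SameVertex (proj₁ (vertex i)) v
    surjective v ty (inj₁ found) = found
    surjective v ty (inj₂ s)     = ⊥-elim (t≢ (trans (sym ty) (K.sameVertex⇒vertexType s)))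
  ... | yes refl = hasSize (Orbits glue (λ d → source d ≡ t)) with-root
    (λ { {zero}  {zero}  _ → refl
       ; {zero}  {suc j} s → ⊥-elim (vertex-nonroot j (sameOrbit-sym s))
       ; {suc i} {zero}  s → ⊥-elim (vertex-nonroot i s)
       ; {suc i} {suc j} s → cong suc (vertex-injective s) })
    λ { (v , ty) → surjective v (vertex-surjective v ty) }
    where
    open NonRoot t
    with-root : Fin (suc (p t)) → Setoid.Carrier (Orbits glue (λ d → source d ≡ t))
    with-root zero    = v₀ , refl
    with-root (suc i) = vertex i
    surjective : ∀ v → (∃[ i ] G.SameVertex (proj₁ (vertex i)) v) ⊎ G.SameVertex v v₀ →
                 ∃[ i ] G.SameVertex (proj₁ (with-root i)) v
    surjective v (inj₁ (i , s)) = suc i , s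
    surjective v (inj₂ s)       = zero , sameOrbit-sym s

  treePointed : TreePointed p
  treePointed = record
    { constellation = constellation
    ; tree          = tree
    ; arborescence  = v₀ , vertexCount , isArborescence , hasVertexCounts , root-count , other-count
    }
    where
    root-count : vertexCount (source v₀) ≡ suc (p (source v₀))
    root-count rewrite dec-true (source v₀ ≟ source v₀) refl = refl
    other-count : ∀ s → s ≢ source v₀ → vertexCount s ≡ p s
    other-count s s≢ rewrite dec-false (s ≟ source v₀) s≢ = refl

  -- Gluing keeps the darts and changes the involution at the buds alone, which are exactly the
  -- darts that the tree marks for cutting; hence the identity on darts.
  opened : ∀ {n} → _≅ᴺ_ {p = p} (treeOpening treePointed , n) nebula
  opened = record
    { isomorphism = record
      { bijection = id
      ; to-σ      = φ-glued
      ; to-α      = to-α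
      }
    ; to-colour   = λ _ → refl
    ; to-type     = λ d → sym (edgeType-glued d)
    ; to-root     = ε
    }
    where
    to-α : ∀ d → (if member d then d else α′ d) ≡ N.α d
    to-α d with N.α d ≟ d
    ... | yes b = sym b
    ... | no ¬b = α′-edge ¬b

theorem5p2 : ∀ (k : ℕ) → 2 ≤ k → (p : Fin k → ℕ) →
    Σ[ nebula ∈ (∀ (X : TreePointed p) → IsNebulaOfType (treeOpening X) p) ]
    IsBijection (_≅ᵀ_ {p = p}) (_≅ᴺ_ {p = p}) (λ X → treeOpening X , nebula X)
theorem5p2 k 2≤k p = nebula , record
  { isInjection = record
    { isCongruent = record
      { cong           = λ {X} {Y} → treeOpening-cong {X = X} {Y} {nebula X} {nebula Y}
      ; isEquivalence₁ = ≅ᵀ-isEquivalence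
      ; isEquivalence₂ = ≅ᴺ-isEquivalence
      }
    ; injective = λ {X} {Y} → treeOpening-injective {X = X} {Y} 2≤k {nebula X} {nebula Y}
    }
  ; surjective = λ N →
      let X = Gluing.treePointed 2≤k N in
      X , λ {Y} Y≅X → IsEquivalence.trans ≅ᴺ-isEquivalence
        {treeOpening Y , nebula Y} {treeOpening X , nebula X} {N}
        (treeOpening-cong {X = Y} {X} {nebula Y} {nebula X} Y≅X) (Gluing.opened 2≤k N {nebula X})
  }
  where
  nebula : ∀ (X : TreePointed p) → IsNebulaOfType (treeOpening X) p
  nebula = Opening.isNebulaOfType 2≤k
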